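{- For a positive integer $k\ge2$, let $u$ and $v$ be two vertices of a $k$-uniform hypergraph $\mathcal{H}$ with $d_{\mathcal{H}}(u)<d_{\mathcal{H}}(v)+s$, where $e_1,\dots,e_s$ are all the pendant hyperedges containing the vertex $u$. Let $\mathcal{H}'$ be the $k$-uniform hypergraph obtained from $\mathcal{H}$ by moving all the pendant hyperedges $e_1,\dots,e_s$ from $u$ to $v$ ($\mathcal{H}'$ is said to be a $\sigma$-transformation of $\mathcal{H}$). Then $\mathcal{H}\prec_\alpha\mathcal{H}'$ for $0<\alpha<1$.
   Context: Hypergraphs are finite; $k$-uniform means every hyperedge has exactly $k$ vertices; $d_{\mathcal{H}}(x)$ is the degree of $x$ in $\mathcal{H}$. A cored vertex is a vertex of degree one. A hyperedge is called a pendant hyperedge if it contains $k-1$ cored vertices. Moving $e_i$ from $u$ to $v$ means replacing $e_i$ by $(e_i\setminus\{u\})\cup\{v\}$, the vertex set being unchanged. For a $k$-uniform hypergraph $\mathcal{H}$ on $[n]$, $\mathcal{A}(\mathcal{H})$ is the $k$-order $n$-dimensional tensor with entry $\frac1{(k-1)!}$ at $(i_1,\dots,i_k)$ if $\{i_1,\dots,i_k\}\in E(\mathcal{H})$ and $0$ otherwise; $\mathcal{D}(\mathcal{H})$ is the diagonal tensor of vertex degrees; $\mathcal{A}_\alpha(\mathcal{H})=\alpha\mathcal{D}(\mathcal{H})+(1-\alpha)\mathcal{A}(\mathcal{H})$. For a tensor $\mathcal{T}$, $\mathrm{Tr}_d(\mathcal{T})$ is the sum of the $d$-th powers of all $n(k-1)^{n-1}$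 eigenvalues of $\mathcal{T}$; in particular $\mathrm{Tr}_0(\mathcal{T})=n(k-1)^{n-1}$, and for $d\ge1$ $$\mathrm{Tr}_{d}(\mathcal{T})=(k-1)^{n-1}\sum_{d_1+\cdots+d_n=d}\ \prod_{i=1}^{n}\frac{1}{(d_i(k-1))!}\Big(\sum_{\gamma\in[n]^{k-1}}(\mathcal{T})_{i\gamma}\frac{\partial}{\partial a_{i\gamma}}\Big)^{d_i}\mathrm{tr}\big(A^{d(k-1)}\big),$$ with $A=(a_{ij})$ an $n\times n$ matrix of indeterminates, $d_i\ge0$ integers, $\frac{\partial}{\partial a_{i\gamma}}=\frac{\partial}{\partial a_{i i_2}}\cdots\frac{\partial}{\partial a_{i i_k}}$ for $\gamma=i_2\cdots i_k$. $S_\alpha$-order: for $k$-uniform hypergraphs $\mathcal{H}_1,\mathcal{H}_2$ with $n$ vertices, $\mathcal{H}_1\prec_\alpha\mathcal{H}_2$ if there is $d\in\{1,\dots,n(k-1)^{n-1}-1\}$ with $\mathrm{Tr}_t(\mathcal{A}_\alpha(\mathcal{H}_1))=\mathrm{Tr}_t(\mathcal{A}_\alpha(\mathcal{H}_2))$ for $t=0,\dots,d-1$ and $\mathrm{Tr}_d(\mathcal{A}_\alpha(\mathcal{H}_1))<\mathrm{Tr}_d(\mathcal{A}_\alpha(\mathcal{H}_2))$.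
   Formalization: It is required that s ≥ 1 (otherwise H' = H) and that no moved hyperedge coincides with a hyperedge already present; for k = 2 and the path u–w–v, moving {u,w} onto {v,w} loses an edge and Tr_1 drops, so the claim fails. -}

module Defs where

open import Level using (Level; _⊔_) renaming (suc to lsuc)
open import Algebra.Apartness.Bundles using (HeytingField)
open import Algebra.Bundles using (CommutativeRing)
import Algebra.Definitions.RawMonoid as RawMonoidOps
open import Data.Bool.Base using (if_then_else_)
import Data.Bool.Properties as Bool
open import Data.Fin.Base using (Fin)
import Data.Fin.Properties as Fin
open import Data.Fin.Subset using (Subset; _∈_; _∩_; _∪_; _-_; ⁅_⁆; ⋃; ∣_∣)
open import Data.Fin.Subset.Properties using (_∈?_)
open import Data.List.Base as List
  using (List; []; _∷_; [_]; length; filter; upTo; allFin; cartesianProductWith; concatMap)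
import Data.List.Membership.DecPropositional as DecMembership
open import Data.List.Relation.Binary.Permutation.Propositional using (_↭_)
open import Data.List.Relation.Unary.All using (All)
open import Data.List.Relation.Unary.Unique.Propositional using (Unique)
open import Data.Nat as ℕ using (ℕ; zero; suc; NonZero; _!)
open import Data.Nat.Properties using (_!≢0)
open import Data.Product using (_×_; _,_; ∃-syntax; proj₁)
open import Data.Product.Properties using (≡-dec)
open import Data.Sum.Base using (_⊎_)
open import Data.Vec.Base as Vec using (Vec; []; _∷_; toList)
import Data.Vec.Properties as Vec
import Data.Vec.Relation.Unary.All as VecAll
open import Relation.Binary.Core using (Rel)
open import Relation.Binary.Definitions using (DecidableEquality)
open import Relation.Binary.PropositionalEquality using (_≡_)
open import Relation.Binary.Structures using (IsStrictPartialOrder)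
open import Relation.Nullary.Decidable using (Dec; does; _×-dec_)

------------------------------------------------------------------------
-- Hypergraphs

-- The list `edges` represents a finite set: it has no repetitions, and
-- nothing below depends on its order.
record Hypergraph (k n : ℕ) : Set where
  field
    edges   : List (Subset n)
    unique  : Unique edges
    uniform : All (λ e → ∣ e ∣ ≡ k) edges

open Hypergraph public

_≟ˢ_ : ∀ {n} → DecidableEquality (Subset n)
_≟ˢ_ = Vec.≡-dec Bool._≟_

module _ {k n : ℕ} (H : Hypergraph k n) where

  degree : Fin n → ℕ
  degree x = length (filter (x ∈?_) (edges H))

  cored : Subset n
  cored = Vec.tabulate (λ x → does (degree x ℕ.≟ 1))

  -- A hyperedge all of whose k vertices are cored also contains k-1 cored
  -- vertices, hence the inequality.
  Pendant : Subset n → Set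
  Pendant e = k ℕ.∸ 1 ℕ.≤ ∣ e ∩ cored ∣

  pendant? : ∀ e → Dec (Pendant e)
  pendant? e = k ℕ.∸ 1 ℕ.≤? ∣ e ∩ cored ∣

  pendantsAt : Fin n → List (Subset n)
  pendantsAt u = filter (λ e → u ∈? e ×-dec pendant? e) (edges H)

  move : Fin n → Fin n → Subset n → Subset n
  move u v e = (e - u) ∪ ⁅ v ⁆

  movePendant : Fin n → Fin n → Subset n → Subset n
  movePendant u v e = if does (u ∈? e ×-dec pendant? e) then move u v e else e

-- Since H′ is itself a Hypergraph, this entails that the moves are
-- legitimate: v lies on no moved hyperedge (else H′ would not be
-- k-uniform) and no moved hyperedge coincides with one already present
-- (else `edges H′` would have repetitions).
IsσTransformation : ∀ {k n} (H : Hypergraph k n) (u v : Fin n)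
                    (H′ : Hypergraph k n) → Set
IsσTransformation H u v H′ = edges H′ ↭ List.map (movePendant H u v) (edges H)

------------------------------------------------------------------------
-- Index sets

-- All elements of [n]^m.
tuples : (n m : ℕ) → List (Vec (Fin n) m)
tuples n zero    = [ [] ]
tuples n (suc m) = cartesianProductWith _∷_ (allFin n) (tuples n m)

-- All (d₁ , … , dₙ) ∈ ℕⁿ with d₁ + ⋯ + dₙ = d.
compositions : (n d : ℕ) → List (Vec ℕ n)
compositions zero    zero    = [ [] ]
compositions zero    (suc d) = []
compositions (suc n) d       =
  concatMap (λ j → List.map (j ∷_) (compositions n (d ℕ.∸ j))) (upTo (suc d))

------------------------------------------------------------------------
-- Ordered fields

-- Order axioms on top of a Heyting field, so that both classical ordered
-- fields and constructive models of the reals are instances.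
record OrderedField c ℓ₁ ℓ₂ : Set (lsuc (c ⊔ ℓ₁ ⊔ ℓ₂)) where
  field
    heytingField : HeytingField c ℓ₁ ℓ₂

  open HeytingField heytingField public

  infix 4 _<_
  field
    _<_                  : Rel Carrier ℓ₂
    isStrictPartialOrder : IsStrictPartialOrder _≈_ _<_
    <⇒#                  : ∀ {x y} → x < y → x # y
    #⇒<⊎>                : ∀ {x y} → x # y → x < y ⊎ y < x
    0<1                  : 0# < 1#
    +-monoˡ-<            : ∀ z {x y} → x < y → x + z < y + z
    *-pos                : ∀ {x y} → 0# < x → 0# < y → 0# < x * y

  open IsStrictPartialOrder isStrictPartialOrder public
    using (<-resp-≈; <-respʳ-≈; <-respˡ-≈)
    renaming (irrefl to <-irrefl; trans to <-trans)

  commutativeRing : CommutativeRing c ℓ₁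
  commutativeRing = record { isCommutativeRing = isCommutativeRing }

  open RawMonoidOps (CommutativeRing.+-rawMonoid commutativeRing) public
    using () renaming (_×_ to _·_)

  fromℕ : ℕ → Carrier
  fromℕ n = n · 1#

  fromℕ-pos : ∀ n → 0# < fromℕ (suc n)
  fromℕ-pos zero    = <-respʳ-≈ (sym (+-identityʳ 1#)) 0<1
  fromℕ-pos (suc n) = <-trans (fromℕ-pos n)
    (<-respˡ-≈ (+-identityˡ _) (+-monoˡ-< (fromℕ (suc n)) 0<1))

  -- The inverse supplied by the field is that of fromℕ n - 0#.
  recip : (n : ℕ) .{{_ : NonZero n}} → Carrier
  recip (suc n) = proj₁ (#⇒invertible (#-sym (<⇒# (fromℕ-pos n))))

  recip! : ℕ → Carrier
  recip! n = recip (n !) {{n !≢0}}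

------------------------------------------------------------------------
-- Tensors, traces and the S_α-order

module Traces {c ℓ₁ ℓ₂} (F : OrderedField c ℓ₁ ℓ₂) where

  open OrderedField F renaming (_-_ to _−_)

  -- The entry at (i , γ) with γ ∈ [n]^(k-1); a k-order n-dimensional
  -- tensor for k ≥ 1.
  Tensor : (k n : ℕ) → Set c
  Tensor k n = Fin n → Vec (Fin n) (k ℕ.∸ 1) → Carrier

  module _ {k n : ℕ} (H : Hypergraph k n) where

    open DecMembership (_≟ˢ_ {n}) using () renaming (_∈?_ to _∈ᴱ?_)

    𝒜 : Tensor k n
    𝒜 i γ = if does (⋃ (List.map ⁅_⁆ (i ∷ toList γ)) ∈ᴱ? edges H)
            then recip! (k ℕ.∸ 1) else 0#

    𝒟 : Tensor k n
    𝒟 i γ = if does (VecAll.all? (i Fin.≟_) γ) then fromℕ (degree H i) else 0#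

    𝒜[_] : Carrier → Tensor k n
    𝒜[ α ] i γ = α * 𝒟 i γ + (1# − α) * 𝒜 i γ

  -- Polynomial expressions over F in the entries a_{ij} of an n × n matrix
  -- of indeterminates.
  infixl 6 _:+_
  infixl 7 _:*_

  data Poly (n : ℕ) : Set c where
    con  : Carrier → Poly n
    var  : Fin n × Fin n → Poly n
    _:+_ : Poly n → Poly n → Poly n
    _:*_ : Poly n → Poly n → Poly n

  module _ {n : ℕ} where

    eval : (Fin n × Fin n → Carrier) → Poly n → Carrier
    eval ρ (con a)  = a
    eval ρ (var x)  = ρ x
    eval ρ (p :+ q) = eval ρ p + eval ρ q
    eval ρ (p :* q) = eval ρ p * eval ρ q

    ∂ : Fin n × Fin n → Poly n → Poly n
    ∂ x (con a)  = con 0#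
    ∂ x (var y)  = con (if does (≡-dec Fin._≟_ Fin._≟_ x y) then 1# else 0#)
    ∂ x (p :+ q) = ∂ x p :+ ∂ x q
    ∂ x (p :* q) = ∂ x p :* q :+ p :* ∂ x q

    -- ∂/∂a_{iγ} = ∂/∂a_{i i₂} ⋯ ∂/∂a_{i i_k}  for γ = i₂⋯i_k
    ∂ᵞ : ∀ {m} → Fin n → Vec (Fin n) m → Poly n → Poly n
    ∂ᵞ i []      p = p
    ∂ᵞ i (j ∷ γ) p = ∂ (i , j) (∂ᵞ i γ p)

    ∑ : ∀ {a} {A : Set a} → List A → (A → Poly n) → Poly n
    ∑ xs f = List.foldr (λ x p → f x :+ p) (con 0#) xs

    -- Entries of A^m, for the generic matrix A = (a_{ij}).
    A^ : ℕ → Fin n → Fin n → Poly n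
    A^ zero    i j = con (if does (i Fin.≟ j) then 1# else 0#)
    A^ (suc m) i j = ∑ (allFin n) λ l → var (i , l) :* A^ m l j

    trA^ : ℕ → Poly n
    trA^ m = ∑ (allFin n) λ i → A^ m i i

    iterate : ℕ → (Poly n → Poly n) → Poly n → Poly n
    iterate zero    f p = p
    iterate (suc m) f p = f (iterate m f p)

  module _ (k : ℕ) {n : ℕ} (T : Tensor k n) where

    -- Σ_γ T_{iγ} ∂/∂a_{iγ}
    ∇ : Fin n → Poly n → Poly n
    ∇ i p = ∑ (tuples n (k ℕ.∸ 1)) λ γ → con (T i γ) :* ∂ᵞ i γ p

    -- ∏_i 1/(d_i (k-1))! (∇ i)^{d_i}
    ∏∇ : Vec ℕ n → Poly n → Poly n
    ∏∇ ds p = List.foldr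
      (λ i q → let dᵢ = Vec.lookup ds i in
               con (recip! (dᵢ ℕ.* (k ℕ.∸ 1))) :* iterate dᵢ (∇ i) q)
      p (allFin n)

    -- ∏∇ ds is of order Σ d_i (k-1) = d(k-1), which is the degree of the
    -- homogeneous polynomial tr(A^{d(k-1)}), so the result of applying it
    -- is a constant; evaluating at 0 reads that constant off.
    Tr : ℕ → Carrier
    Tr zero      = fromℕ (n ℕ.* (k ℕ.∸ 1) ℕ.^ (n ℕ.∸ 1))
    Tr d@(suc _) = fromℕ ((k ℕ.∸ 1) ℕ.^ (n ℕ.∸ 1))
      * eval (λ _ → 0#)
          (∑ (compositions n d) λ ds → ∏∇ ds (trA^ (d ℕ.* (k ℕ.∸ 1))))

  _≺[_]_ : ∀ {k n} → Hypergraph k n → Carrier → Hypergraph k n → Set (ℓ₁ ⊔ ℓ₂)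
  _≺[_]_ {k} {n} H₁ α H₂ =
    ∃[ d ] 1 ℕ.≤ d
         × d ℕ.≤ n ℕ.* (k ℕ.∸ 1) ℕ.^ (n ℕ.∸ 1) ℕ.∸ 1
         × (∀ t → t ℕ.< d → Tr k (𝒜[_] H₁ α) t ≈ Tr k (𝒜[_] H₂ α) t)
         × Tr k (𝒜[_] H₁ α) d < Tr k (𝒜[_] H₂ α) d

{-# OPTIONS --safe #-}
-- The traces agree up to d = 1 and differ at d = 2. The differential operators
-- only see closed walks that use exactly the prescribed arcs, so Tr₁ is
-- (k-1)^(n-1) times the sum of the diagonal entries T_{i⋯i}, and Tr₂ is
-- (k-1)^(n-1) times the sum of their squares plus an interaction of the rows
-- i < j. For 𝒜_α the diagonal entries are α d(i). The interaction vanishes for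
-- k ≥ 3, since an edge through i has a vertex outside {i , j}, from which a walk
-- cannot return, and for k = 2 it depends on the number of edges alone. Hence
-- Tr₁ is preserved together with Σ d, while Tr₂ grows with Σ d², because
-- d′(u) = d(u) - s, d′(v) = d(v) + s and d(u) < d(v) + s.
module Submission where

open import Defs
open import Algebra.Bundles using (CommutativeMonoid; CommutativeRing; CommutativeSemiring)
import Algebra.Properties.CommutativeSemigroup as CommutativeSemigroupProperties
import Algebra.Properties.Ring as RingProperties
import Algebra.Properties.Semiring.Mult as SemiringMult
import Algebra.Solver.CommutativeMonoid as CommutativeMonoidSolver
import Algebra.Solver.Ring.NaturalCoefficients.Default as NaturalCoefficients
open import Algebra.Structures.Biased using (IsCommutativeSemiringˡ)
open import Data.Bool.Base using (true; false; if_then_else_)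
open import Data.Fin.Base using (Fin; zero; suc)
import Data.Fin.Properties as Fin
open import Data.Fin.Subset as Subset using (Subset; _∪_; ⁅_⁆; ⋃; ∣_∣) renaming (⊥ to ∅)
open import Data.Fin.Subset.Properties
  using (x∈⁅x⁆; x∈⁅y⁆⇒x≡y; x∈p∪q⁺; x∈p∪q⁻; x∈p∧x≢y⇒x∈p-y; x∈p⇒∣p-x∣<∣p∣; p─q⊆p; ∣p∣≤n;
         ∣p∣≡n⇒p≡⊤; ∈⊤; _∈?_; ∪-identityˡ; ∪-identityʳ; ∪-comm; ∉⊥; p⊆q⇒∣p∣≤∣q∣; ∣⁅x⁆∣≡1)
open import Data.List.Base as List
  using (List; []; _∷_; [_]; _++_; length; map; foldr; filter; upTo; allFin; concatMap)
import Data.List.Membership.DecPropositional as DecMembership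
open import Data.List.Membership.Propositional using (_∈_; _∉_; find; lose)
open import Data.List.Membership.Propositional.Properties using (∈-map⁺; ∈-++⁺ˡ; ∈-++⁺ʳ; ∈-filter⁻)
import Data.List.Properties as List
open import Data.List.Relation.Binary.Permutation.Propositional.Properties
  using (All-resp-↭; ↭-length; filter-↭)
open import Data.List.Relation.Unary.All as All using (All; []; _∷_)
import Data.List.Relation.Unary.All.Properties as All
open import Data.List.Relation.Unary.AllPairs using ([]; _∷_)
open import Data.List.Relation.Unary.Any as Any using (here; there)
open import Data.List.Relation.Unary.Unique.Propositional using (Unique)
open import Data.Nat as ℕ using (ℕ; zero; suc; _!)
import Data.Nat.Properties as ℕ
import Data.Nat.Tactic.RingSolver as ℕ
open import Data.Product using (_×_; _,_; proj₁; proj₂; ∃-syntax)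
open import Data.Product.Properties using (≡-dec)
open import Data.Sum.Base using (_⊎_; inj₁; inj₂)
open import Data.Unit.Base using (⊤; tt)
open import Data.Vec.Base as Vec using (Vec; []; _∷_; there)
import Data.Vec.Properties as Vec
import Data.Vec.Relation.Unary.All as VecAll
open import Function.Base using (_∘_; id; case_of_)
open import Function.Bundles using (_⇔_; mk⇔)
open import Level using (Level; _⊔_)
open import Relation.Binary.Definitions using (DecidableEquality)
open import Relation.Binary.PropositionalEquality as ≡ using (_≡_; _≢_)
import Relation.Binary.Reasoning.Setoid as SetoidReasoning
open import Relation.Binary.Structures using (IsEquivalence)
open import Relation.Nullary.Decidable
  using (Dec; does; does-⇔; ¬?; _×-dec_; yes; no; dec-true; dec-false)
open import Relation.Nullary.Negation using (¬_; contradiction)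

-- The exponent d(k-1) of the trace polynomial is symbolic, so tr A^{d(k-1)} cannot be expanded into
-- monomials before differentiating. The way around this is that an indeterminate which is never
-- differentiated survives every derivation and is evaluated at 0 in the end; it may therefore be
-- set to 0 beforehand. Three choices of the indeterminates to keep suffice: the arcs that do not
-- leave a fixed vertex l, where row l becomes null; the loops, where A becomes a diagonal matrix;
-- and all arcs, used for the explicit polynomial tr A^2 of the graph case.
--
-- On the side of degrees, Σ d² changes by s(2d(v) + s) - s(2d′(u) + s) = 2s(d(v) - d′(u)), so the
-- assumption on d(u) is precisely the positivity of this change.
--
-- The order admits only indices below the number of eigenvalues. That index 2 is admissible needs n
-- ≥ 3, which follows from a moved edge missing v.

private
  variable
    a b : Level
    A : Set a
    B : Set b

-- Finite index sets and small subsets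

allFin-suc : ∀ n → allFin (suc n) ≡ zero ∷ map suc (allFin n)
allFin-suc n = ≡.cong (zero ∷_) (≡.sym (List.map-tabulate id suc))

∣p∣≡0⇒p≡⊥ : ∀ {n} (p : Subset n) → ∣ p ∣ ≡ 0 → p ≡ ∅
∣p∣≡0⇒p≡⊥ []          _  = ≡.refl
∣p∣≡0⇒p≡⊥ (false ∷ p) eq = ≡.cong (false ∷_) (∣p∣≡0⇒p≡⊥ p eq)

∣p∣≡1⇒p≡⁅x⁆ : ∀ {n} (p : Subset n) → ∣ p ∣ ≡ 1 → ∃[ x ] p ≡ ⁅ x ⁆
∣p∣≡1⇒p≡⁅x⁆ (true ∷ p)  eq = zero , ≡.cong (true ∷_) (∣p∣≡0⇒p≡⊥ p (ℕ.suc-injective eq))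
∣p∣≡1⇒p≡⁅x⁆ (false ∷ p) eq with ∣p∣≡1⇒p≡⁅x⁆ p eq
... | x , p≡ = suc x , ≡.cong (false ∷_) p≡

∣p∪q∣≤∣p∣+∣q∣ : ∀ {n} (p q : Subset n) → ∣ p ∪ q ∣ ℕ.≤ ∣ p ∣ ℕ.+ ∣ q ∣
∣p∪q∣≤∣p∣+∣q∣ []          []          = ℕ.z≤n
∣p∪q∣≤∣p∣+∣q∣ (false ∷ p) (false ∷ q) = ∣p∪q∣≤∣p∣+∣q∣ p q
∣p∪q∣≤∣p∣+∣q∣ (false ∷ p) (true ∷ q)  = ℕ.≤-trans (ℕ.s≤s (∣p∪q∣≤∣p∣+∣q∣ p q)) (ℕ.≤-reflexive (≡.sym (ℕ.+-suc ∣ p ∣ ∣ q ∣)))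
∣p∪q∣≤∣p∣+∣q∣ (true ∷ p)  (false ∷ q) = ℕ.s≤s (∣p∪q∣≤∣p∣+∣q∣ p q)
∣p∪q∣≤∣p∣+∣q∣ (true ∷ p)  (true ∷ q)  = ℕ.s≤s (ℕ.≤-trans (∣p∪q∣≤∣p∣+∣q∣ p q) (ℕ.+-monoʳ-≤ ∣ p ∣ (ℕ.n≤1+n ∣ q ∣)))

-- Finite sums in a commutative monoid

module ListSum {c ℓ} (M : CommutativeMonoid c ℓ) where

  open CommutativeMonoid M
  open SetoidReasoning setoid
  open CommutativeMonoidSolver M using (solve; _⊕_; _⊜_)

  sum : List A → (A → Carrier) → Carrier
  sum xs f = foldr (λ x s → f x ∙ s) ε xs

  sum-cong : ∀ (xs : List A) {f g : A → Carrier} → (∀ x → f x ≈ g x) → sum xs f ≈ sum xs g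
  sum-cong []       f≈g = refl
  sum-cong (x ∷ xs) f≈g = ∙-cong (f≈g x) (sum-cong xs f≈g)

  sum-zero : ∀ (xs : List A) {f : A → Carrier} → (∀ x → f x ≈ ε) → sum xs f ≈ ε
  sum-zero []       f≈ε = refl
  sum-zero (x ∷ xs) f≈ε = trans (∙-cong (f≈ε x) (sum-zero xs f≈ε)) (identityˡ ε)

  sum-∙ : ∀ (xs : List A) (f g : A → Carrier) → sum xs (λ x → f x ∙ g x) ≈ sum xs f ∙ sum xs g
  sum-∙ []       f g = sym (identityˡ ε)
  sum-∙ (x ∷ xs) f g = begin
    (f x ∙ g x) ∙ sum xs (λ y → f y ∙ g y) ≈⟨ ∙-congˡ (sum-∙ xs f g) ⟩
    (f x ∙ g x) ∙ (sum xs f ∙ sum xs g)     ≈⟨ solve 4 (λ p q r s → (p ⊕ q) ⊕ (r ⊕ s) ⊜ (p ⊕ r) ⊕ (q ⊕ s)) refl (f x) (g x) (sum xs f) (sum xs g) ⟩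
    (f x ∙ sum xs f) ∙ (g x ∙ sum xs g)     ∎

  sum-map : ∀ (h : A → B) (xs : List A) {f : B → Carrier} → sum (map h xs) f ≡ sum xs (f ∘ h)
  sum-map h xs = List.foldr-map _ _ _ xs

  sum-++ : ∀ (xs : List A) {ys : List A} {f : A → Carrier} → sum (xs ++ ys) f ≈ sum xs f ∙ sum ys f
  sum-++ []       = sym (identityˡ _)
  sum-++ (x ∷ xs) = trans (∙-congˡ (sum-++ xs)) (sym (assoc _ _ _))

  sum-concatMap : ∀ (h : A → List B) (xs : List A) {f : B → Carrier} →
                  sum (concatMap h xs) f ≈ sum xs (λ x → sum (h x) f)
  sum-concatMap h []       = refl
  sum-concatMap h (x ∷ xs) = trans (sum-++ (h x)) (∙-congˡ (sum-concatMap h xs))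

  sum-cartesianProductWith : ∀ {d} {D : Set d} (h : A → B → D) (xs : List A) (ys : List B) {f : D → Carrier} →
                             sum (List.cartesianProductWith h xs ys) f ≈ sum xs (λ x → sum ys (λ y → f (h x y)))
  sum-cartesianProductWith h []       ys = refl
  sum-cartesianProductWith h (x ∷ xs) ys = trans (sum-++ (map (h x) ys))
    (∙-cong (reflexive (sum-map (h x) ys)) (sum-cartesianProductWith h xs ys))

  sum-comm : ∀ (xs : List A) (ys : List B) (f : A → B → Carrier) →
             sum xs (λ x → sum ys (f x)) ≈ sum ys (λ y → sum xs (λ x → f x y))
  sum-comm []       ys f = sym (sum-zero ys (λ _ → refl))
  sum-comm (x ∷ xs) ys f = trans (∙-congˡ (sum-comm xs ys f)) (sym (sum-∙ ys (f x) _))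

  sum-allFin-suc : ∀ {n} (f : Fin (suc n) → Carrier) → sum (allFin (suc n)) f ≡ f zero ∙ sum (allFin n) (f ∘ suc)
  sum-allFin-suc {n} f = ≡.trans (≡.cong (λ xs → sum xs f) (allFin-suc n)) (≡.cong (f zero ∙_) (sum-map suc (allFin n)))

  sum-allFin-single : ∀ {n} (i : Fin n) {f : Fin n → Carrier} → (∀ j → j ≢ i → f j ≈ ε) → sum (allFin n) f ≈ f i
  sum-allFin-single zero    {f} f≈ε = begin
    sum (allFin _) f                  ≡⟨ sum-allFin-suc f ⟩
    f zero ∙ sum (allFin _) (f ∘ suc) ≈⟨ ∙-congˡ (sum-zero (allFin _) (λ j → f≈ε (suc j) λ ())) ⟩
    f zero ∙ ε                        ≈⟨ identityʳ _ ⟩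
    f zero                            ∎
  sum-allFin-single (suc i) {f} f≈ε = begin
    sum (allFin _) f                  ≡⟨ sum-allFin-suc f ⟩
    f zero ∙ sum (allFin _) (f ∘ suc) ≈⟨ ∙-cong (f≈ε zero λ ()) (sum-allFin-single i (λ j j≢i → f≈ε (suc j) (j≢i ∘ Fin.suc-injective))) ⟩
    ε ∙ f (suc i)                     ≈⟨ identityˡ _ ⟩
    f (suc i)                         ∎

  sum-tuples-single : ∀ {n m} (δ : Vec (Fin n) m) {f : Vec (Fin n) m → Carrier} →
                      (∀ γ → γ ≢ δ → f γ ≈ ε) → sum (tuples n m) f ≈ f δ
  sum-tuples-single             []      f≈ε = identityʳ _
  sum-tuples-single {n} {suc m} (i ∷ δ) {f} f≈ε = begin
    sum (tuples n (suc m)) f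
      ≈⟨ sum-cartesianProductWith _∷_ (allFin n) (tuples n m) ⟩
    sum (allFin n) (λ j → sum (tuples n m) (λ γ → f (j ∷ γ)))
      ≈⟨ sum-allFin-single i (λ j j≢i → sum-zero (tuples n m) (λ γ → f≈ε (j ∷ γ) (j≢i ∘ ≡.cong Vec.head))) ⟩
    sum (tuples n m) (λ γ → f (i ∷ γ))
      ≈⟨ sum-tuples-single δ (λ γ γ≢δ → f≈ε (i ∷ γ) (γ≢δ ∘ ≡.cong Vec.tail)) ⟩
    f (i ∷ δ) ∎

  -- The sum over i < j. Splitting off `zero` mirrors the way `compositions` splits off its first
  -- entry, so the two recursions can be compared directly.
  pairSum : (n : ℕ) → (Fin n → Fin n → Carrier) → Carrier
  pairSum zero    f = ε
  pairSum (suc n) f = sum (allFin n) (λ j → f zero (suc j)) ∙ pairSum n (λ i j → f (suc i) (suc j))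

  pairSum-cong : ∀ n {f g : Fin n → Fin n → Carrier} → (∀ i j → i ≢ j → f i j ≈ g i j) → pairSum n f ≈ pairSum n g
  pairSum-cong zero    f≈g = refl
  pairSum-cong (suc n) f≈g = ∙-cong (sum-cong (allFin n) (λ j → f≈g zero (suc j) λ ()))
                                    (pairSum-cong n (λ i j i≢j → f≈g (suc i) (suc j) (i≢j ∘ Fin.suc-injective)))

  pairSum-zero : ∀ n {f : Fin n → Fin n → Carrier} → (∀ i j → i ≢ j → f i j ≈ ε) → pairSum n f ≈ ε
  pairSum-zero zero    f≈ε = refl
  pairSum-zero (suc n) f≈ε = trans
    (∙-cong (sum-zero (allFin n) (λ j → f≈ε zero (suc j) λ ()))
            (pairSum-zero n (λ i j i≢j → f≈ε (suc i) (suc j) (i≢j ∘ Fin.suc-injective))))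
    (identityˡ ε)

  pairSum-sum : ∀ n (xs : List A) (f : A → Fin n → Fin n → Carrier) →
                pairSum n (λ i j → sum xs (λ x → f x i j)) ≈ sum xs (λ x → pairSum n (f x))
  pairSum-sum zero    xs f = sym (sum-zero xs (λ _ → refl))
  pairSum-sum (suc n) xs f = trans
    (∙-cong (sum-comm (allFin n) xs _) (pairSum-sum n xs (λ x i j → f x (suc i) (suc j))))
    (sym (sum-∙ xs _ _))

  indicator : ∀ {p} {P : Set p} → Dec P → Carrier → Carrier
  indicator P? x = if does P? then x else ε

  indicator-true : ∀ {p} {P : Set p} (P? : Dec P) {x} → P → indicator P? x ≡ x
  indicator-true P? p = ≡.cong (if_then _ else ε) (dec-true P? p)

  indicator-false : ∀ {p} {P : Set p} (P? : Dec P) {x} → ¬ P → indicator P? x ≡ ε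
  indicator-false P? ¬p = ≡.cong (if_then _ else ε) (dec-false P? ¬p)

  indicator-⇔ : ∀ {p q} {P : Set p} {Q : Set q} (P? : Dec P) (Q? : Dec Q) {x} → P ⇔ Q → indicator P? x ≡ indicator Q? x
  indicator-⇔ P? Q? P⇔Q = ≡.cong (if_then _ else ε) (does-⇔ P⇔Q P? Q?)

  sum-indicator-∉ : ∀ (_≟_ : DecidableEquality A) {z xs} x → z ∉ xs → sum xs (λ y → indicator (z ≟ y) x) ≈ ε
  sum-indicator-∉ _≟_ {xs = []}     x z∉ = refl
  sum-indicator-∉ _≟_ {z} {y ∷ xs} x z∉ = trans
    (∙-cong (reflexive (indicator-false (z ≟ y) (z∉ ∘ here))) (sum-indicator-∉ _≟_ x (z∉ ∘ there)))
    (identityˡ ε)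

  sum-indicator-∈ : ∀ (_≟_ : DecidableEquality A) {z xs} x → Unique xs → z ∈ xs → sum xs (λ y → indicator (z ≟ y) x) ≈ x
  sum-indicator-∈ _≟_ {z} x (z∉ ∷ _) (here ≡.refl) = trans
    (∙-cong (reflexive (indicator-true (z ≟ z) ≡.refl)) (sum-indicator-∉ _≟_ x (All.All¬⇒¬Any z∉)))
    (identityʳ x)
  sum-indicator-∈ _≟_ {z} {y ∷ _} x (y∉ ∷ uniq) (there z∈) = trans
    (∙-cong (reflexive (indicator-false (z ≟ y) (λ { ≡.refl → All.All¬⇒¬Any y∉ z∈ }))) (sum-indicator-∈ _≟_ x uniq z∈))
    (identityˡ x)

  -- A two-element set is {i , j} for exactly one pair i < j. If `zero` lies in it, what is left is
  -- a singleton that determines j; otherwise no pair involving `zero` matches and the recursion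
  -- applies.
  pairSum-edge : ∀ {n} (e : Subset n) x → ∣ e ∣ ≡ 2 → pairSum n (λ i j → indicator ((⁅ i ⁆ ∪ ⁅ j ⁆) ≟ˢ e) x) ≈ x
  pairSum-edge {suc n} (false ∷ e) x ∣e∣≡2 = trans
    (∙-cong (sum-zero (allFin n) λ j → reflexive (indicator-false ((⁅ zero ⁆ ∪ ⁅ suc j ⁆) ≟ˢ (false ∷ e)) {x} λ ()))
            (trans (pairSum-cong n λ i j _ → reflexive (indicator-⇔ ((⁅ suc i ⁆ ∪ ⁅ suc j ⁆) ≟ˢ (false ∷ e)) ((⁅ i ⁆ ∪ ⁅ j ⁆) ≟ˢ e)
                     (mk⇔ (≡.cong Vec.tail) (≡.cong (false ∷_)))))
                   (pairSum-edge e x ∣e∣≡2)))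
    (identityˡ x)
  pairSum-edge {suc n} (true ∷ e) x ∣e∣≡2 with ∣p∣≡1⇒p≡⁅x⁆ e (ℕ.suc-injective ∣e∣≡2)
  ... | a , ≡.refl = trans
    (∙-cong (trans (sum-allFin-single a λ j j≢a → reflexive (indicator-false (q j ≟ˢ (true ∷ ⁅ a ⁆)) λ eq →
                      j≢a (x∈⁅y⁆⇒x≡y a (≡.subst (j Subset.∈_) (≡.trans (≡.sym (∪-identityˡ ⁅ j ⁆)) (≡.cong Vec.tail eq)) (x∈⁅x⁆ j)))))
                   (reflexive (indicator-true (q a ≟ˢ (true ∷ ⁅ a ⁆)) (≡.cong (true ∷_) (∪-identityˡ ⁅ a ⁆)))))
            (pairSum-zero n λ i j _ → reflexive (indicator-false ((⁅ suc i ⁆ ∪ ⁅ suc j ⁆) ≟ˢ (true ∷ ⁅ a ⁆)) {x} λ ())))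
    (identityʳ x)
    where
    q : Fin n → Subset (suc n)
    q j = ⁅ zero ⁆ ∪ ⁅ suc j ⁆

-- Degrees under a σ-transformation

module ΣN = ListSum ℕ.+-0-commutativeMonoid

length-filter-sum : ∀ {p} {P : A → Set p} (P? : ∀ x → Dec (P x)) (xs : List A) →
                    length (filter P? xs) ≡ ΣN.sum xs (λ x → ΣN.indicator (P? x) 1)
length-filter-sum P? []       = ≡.refl
length-filter-sum P? (x ∷ xs) with P? x
... | yes _ = ≡.cong suc (length-filter-sum P? xs)
... | no _  = length-filter-sum P? xs

x∉p-x : ∀ {n} {x : Fin n} (p : Subset n) → x Subset.∉ p Subset.- x
x∉p-x {x = zero}  (false ∷ p) ()
x∉p-x {x = zero}  (true ∷ p)  ()
x∉p-x {x = suc x} (_ ∷ p) (there x∈) = x∉p-x p x∈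

module σTransformation {k n : ℕ} (H : Hypergraph k n) {u v : Fin n} (u≢v : u ≢ v)
                       (H′ : Hypergraph k n) (isσ : IsσTransformation H u v H′) where

  s : ℕ
  s = length (pendantsAt H u)

  Moved : Subset n → Set
  Moved e = u Subset.∈ e × Pendant H e

  -- The very test made by both `pendantsAt` and `movePendant`, so that s counts the edges that are
  -- actually moved.
  moved? : ∀ e → Dec (Moved e)
  moved? e = u ∈? e ×-dec pendant? H e

  v∈move : ∀ e → v Subset.∈ move H u v e
  v∈move e = x∈p∪q⁺ {p = e Subset.- u} (inj₂ (x∈⁅x⁆ v))

  u∉move : ∀ e → u Subset.∉ move H u v e
  u∉move e u∈ with x∈p∪q⁻ (e Subset.- u) ⁅ v ⁆ u∈
  ... | inj₁ u∈e-u = x∉p-x e u∈e-u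
  ... | inj₂ u∈v   = u≢v (x∈⁅y⁆⇒x≡y v u∈v)

  move-⇔ : ∀ {x} e → x ≢ u → x ≢ v → x Subset.∈ move H u v e ⇔ x Subset.∈ e
  move-⇔ {x} e x≢u x≢v = mk⇔ to (λ x∈e → x∈p∪q⁺ (inj₁ (x∈p∧x≢y⇒x∈p-y x∈e x≢u)))
    where
    to : x Subset.∈ move H u v e → x Subset.∈ e
    to x∈ with x∈p∪q⁻ (e Subset.- u) ⁅ v ⁆ x∈
    ... | inj₁ x∈e-u = p─q⊆p e ⁅ u ⁆ x∈e-u
    ... | inj₂ x∈v   = contradiction (x∈⁅y⁆⇒x≡y v x∈v) x≢v

  -- If v were on a moved edge e, moving e would just delete u from it.
  v∉e : ∀ {e} → u Subset.∈ e → ∣ e ∣ ≡ k → ∣ move H u v e ∣ ≡ k → v Subset.∉ e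
  v∉e {e} u∈e ∣e∣≡k ∣me∣≡k v∈e = ℕ.<-irrefl (≡.trans ∣me∣≡k (≡.sym ∣e∣≡k))
    (ℕ.≤-<-trans (p⊆q⇒∣p∣≤∣q∣ shrinks) (x∈p⇒∣p-x∣<∣p∣ u∈e))
    where
    shrinks : move H u v e Subset.⊆ e Subset.- u
    shrinks x∈ with x∈p∪q⁻ (e Subset.- u) ⁅ v ⁆ x∈
    ... | inj₁ x∈e-u = x∈e-u
    ... | inj₂ x∈v rewrite x∈⁅y⁆⇒x≡y v x∈v = x∈p∧x≢y⇒x∈p-y v∈e (≡.≢-sym u≢v)

  uniform-moved : All (λ e → ∣ movePendant H u v e ∣ ≡ k) (edges H)
  uniform-moved = All.map⁻ (All-resp-↭ isσ (uniform H′))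

  -- The loss at u is added on the left instead of being subtracted on the right, which keeps the
  -- identity within ℕ. The decision is an argument, so that matching on it reduces e′.
  edgeCount : ∀ x {e} (moved : Dec (Moved e)) → let e′ = if does moved then move H u v e else e in
              ∣ e ∣ ≡ k → ∣ e′ ∣ ≡ k →
              ΣN.indicator (x ∈? e′) 1 ℕ.+ ΣN.indicator (x Fin.≟ u) (ΣN.indicator moved 1) ≡
              ΣN.indicator (x ∈? e) 1 ℕ.+ ΣN.indicator (x Fin.≟ v) (ΣN.indicator moved 1)
  edgeCount x {e} (no _) _ _ =
    ≡.cong (ΣN.indicator (x ∈? e) 1 ℕ.+_) (≡.trans (none (x Fin.≟ u)) (≡.sym (none (x Fin.≟ v))))
    where
    none : ∀ {p} {P : Set p} (P? : Dec P) → ΣN.indicator P? 0 ≡ 0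
    none (yes _) = ≡.refl
    none (no _)  = ≡.refl
  edgeCount x {e} (yes (u∈e , _)) ∣e∣≡k ∣e′∣≡k = cases (x Fin.≟ u) (x Fin.≟ v)
    where
    cases : (x≟u : Dec (x ≡ u)) (x≟v : Dec (x ≡ v)) →
            ΣN.indicator (x ∈? move H u v e) 1 ℕ.+ ΣN.indicator x≟u 1 ≡ ΣN.indicator (x ∈? e) 1 ℕ.+ ΣN.indicator x≟v 1
    cases (yes ≡.refl) (yes ≡.refl) = contradiction ≡.refl u≢v
    cases (yes ≡.refl) (no _)
      rewrite ΣN.indicator-false (u ∈? move H u v e) {1} (u∉move e) | ΣN.indicator-true (u ∈? e) {1} u∈e = ≡.refl
    cases (no _) (yes ≡.refl)
      rewrite ΣN.indicator-true (v ∈? move H u v e) {1} (v∈move e)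
            | ΣN.indicator-false (v ∈? e) {1} (v∉e u∈e ∣e∣≡k ∣e′∣≡k) = ≡.refl
    cases (no x≢u) (no x≢v) =
      ≡.cong (ℕ._+ 0) (ΣN.indicator-⇔ (x ∈? move H u v e) (x ∈? e) (move-⇔ e x≢u x≢v))

  sum-edgeCount : ∀ x {es} → All (λ e → ∣ e ∣ ≡ k) es → All (λ e → ∣ movePendant H u v e ∣ ≡ k) es →
    ΣN.sum es (λ e → ΣN.indicator (x ∈? movePendant H u v e) 1 ℕ.+ ΣN.indicator (x Fin.≟ u) (ΣN.indicator (moved? e) 1)) ≡
    ΣN.sum es (λ e → ΣN.indicator (x ∈? e) 1 ℕ.+ ΣN.indicator (x Fin.≟ v) (ΣN.indicator (moved? e) 1))
  sum-edgeCount x []       []       = ≡.refl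
  sum-edgeCount x (p ∷ ps) (q ∷ qs) = ≡.cong₂ ℕ._+_ (edgeCount x (moved? _) p q) (sum-edgeCount x ps qs)

  sum-indicator : ∀ {p} {P : Set p} (P? : Dec P) → ΣN.sum (edges H) (λ e → ΣN.indicator P? (ΣN.indicator (moved? e) 1)) ≡ ΣN.indicator P? s
  sum-indicator (yes _) = ≡.sym (length-filter-sum moved? (edges H))
  sum-indicator (no _)  = ΣN.sum-zero (edges H) (λ _ → ≡.refl)

  degree-balance : ∀ x → degree H′ x ℕ.+ ΣN.indicator (x Fin.≟ u) s ≡ degree H x ℕ.+ ΣN.indicator (x Fin.≟ v) s
  degree-balance x = begin
    degree H′ x ℕ.+ ΣN.indicator (x Fin.≟ u) s
      ≡⟨ ≡.cong₂ ℕ._+_ degree′ (≡.sym (sum-indicator (x Fin.≟ u))) ⟩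
    ΣN.sum (edges H) (λ e → ΣN.indicator (x ∈? movePendant H u v e) 1) ℕ.+
    ΣN.sum (edges H) (λ e → ΣN.indicator (x Fin.≟ u) (ΣN.indicator (moved? e) 1))
      ≡⟨ ΣN.sum-∙ (edges H) _ _ ⟨
    ΣN.sum (edges H) (λ e → ΣN.indicator (x ∈? movePendant H u v e) 1 ℕ.+ ΣN.indicator (x Fin.≟ u) (ΣN.indicator (moved? e) 1))
      ≡⟨ sum-edgeCount x (uniform H) uniform-moved ⟩
    ΣN.sum (edges H) (λ e → ΣN.indicator (x ∈? e) 1 ℕ.+ ΣN.indicator (x Fin.≟ v) (ΣN.indicator (moved? e) 1))
      ≡⟨ ΣN.sum-∙ (edges H) _ _ ⟩
    ΣN.sum (edges H) (λ e → ΣN.indicator (x ∈? e) 1) ℕ.+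
    ΣN.sum (edges H) (λ e → ΣN.indicator (x Fin.≟ v) (ΣN.indicator (moved? e) 1))
      ≡⟨ ≡.cong₂ ℕ._+_ (≡.sym (length-filter-sum (x ∈?_) (edges H))) (sum-indicator (x Fin.≟ v)) ⟩
    degree H x ℕ.+ ΣN.indicator (x Fin.≟ v) s ∎
    where
    open ≡.≡-Reasoning
    degree′ : degree H′ x ≡ ΣN.sum (edges H) (λ e → ΣN.indicator (x ∈? movePendant H u v e) 1)
    degree′ = ≡.trans (↭-length (filter-↭ (x ∈?_) isσ))
      (≡.trans (length-filter-sum (x ∈?_) (map (movePendant H u v) (edges H))) (ΣN.sum-map (movePendant H u v) (edges H)))

  -- A correction that vanishes with its second argument is concentrated at x. It is applied to a
  -- linear correction for Σ d and to a quadratic one for Σ d².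
  sum-at : ∀ x (f : Fin n → ℕ → ℕ) → (∀ y → f y 0 ≡ 0) →
           ΣN.sum (allFin n) (λ y → f y (ΣN.indicator (y Fin.≟ x) s)) ≡ f x s
  sum-at x f f0 = ≡.trans
    (ΣN.sum-allFin-single x λ y y≢x → ≡.trans (≡.cong (f y) (ΣN.indicator-false (y Fin.≟ x) y≢x)) (f0 y))
    (≡.cong (f x) (ΣN.indicator-true (x Fin.≟ x) ≡.refl))

  degreeSum squareSum : Hypergraph k n → ℕ
  degreeSum G = ΣN.sum (allFin n) (degree G)
  squareSum G = ΣN.sum (allFin n) λ x → degree G x ℕ.* degree G x

  degreeSum-≡ : degreeSum H ≡ degreeSum H′
  degreeSum-≡ = ≡.sym (ℕ.+-cancelʳ-≡ s (degreeSum H′) (degreeSum H)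
    (≡.trans (shifted H′ u) (≡.trans (ΣN.sum-cong (allFin n) degree-balance) (≡.sym (shifted H v)))))
    where
    shifted : ∀ G x → degreeSum G ℕ.+ s ≡ ΣN.sum (allFin n) λ y → degree G y ℕ.+ ΣN.indicator (y Fin.≟ x) s
    shifted G x = ≡.trans (≡.cong (degreeSum G ℕ.+_) (≡.sym (sum-at x (λ _ t → t) (λ _ → ≡.refl)))) (≡.sym (ΣN.sum-∙ (allFin n) _ _))

  -- Both sides of `degree-balance` are squared and summed. Since (d + t)² = d² + t(2d + t), each
  -- side exceeds its sum of squares at a single vertex only: u for H′ and v for H.
  squareSum-balance : squareSum H′ ℕ.+ s ℕ.* (degree H′ u ℕ.+ degree H′ u ℕ.+ s) ≡
                      squareSum H ℕ.+ s ℕ.* (degree H v ℕ.+ degree H v ℕ.+ s)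
  squareSum-balance = ≡.trans (shifted H′ u) (≡.trans
    (ΣN.sum-cong (allFin n) λ y → ≡.cong (λ d → d ℕ.* d) (degree-balance y)) (≡.sym (shifted H v)))
    where
    square : ∀ d t → d ℕ.* d ℕ.+ t ℕ.* (d ℕ.+ d ℕ.+ t) ≡ (d ℕ.+ t) ℕ.* (d ℕ.+ t)
    square = ℕ.solve-∀
    shifted : ∀ G x → squareSum G ℕ.+ s ℕ.* (degree G x ℕ.+ degree G x ℕ.+ s) ≡
      ΣN.sum (allFin n) λ y → (degree G y ℕ.+ ΣN.indicator (y Fin.≟ x) s) ℕ.* (degree G y ℕ.+ ΣN.indicator (y Fin.≟ x) s)
    shifted G x = ≡.trans
      (≡.cong (squareSum G ℕ.+_) (≡.sym (sum-at x (λ y t → t ℕ.* (degree G y ℕ.+ degree G y ℕ.+ t)) (λ _ → ≡.refl))))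
      (≡.trans (≡.sym (ΣN.sum-∙ (allFin n) _ _))
        (ΣN.sum-cong (allFin n) λ y → square (degree G y) (ΣN.indicator (y Fin.≟ x) s)))

  squareSum-< : 1 ℕ.≤ s → degree H u ℕ.< degree H v ℕ.+ s → squareSum H ℕ.< squareSum H′
  squareSum-< 1≤s du<dv+s = ℕ.+-cancelʳ-< (s ℕ.* (d′u ℕ.+ d′u ℕ.+ s)) (squareSum H) (squareSum H′) (begin-strict
    squareSum H ℕ.+ s ℕ.* (d′u ℕ.+ d′u ℕ.+ s)
      <⟨ ℕ.+-monoʳ-< (squareSum H) (ℕ.*-monoʳ-< s {{ℕ.>-nonZero 1≤s}} (ℕ.+-monoˡ-< s (ℕ.+-mono-< d′u<dv d′u<dv))) ⟩
    squareSum H ℕ.+ s ℕ.* (degree H v ℕ.+ degree H v ℕ.+ s)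
      ≡⟨ squareSum-balance ⟨
    squareSum H′ ℕ.+ s ℕ.* (d′u ℕ.+ d′u ℕ.+ s) ∎)
    where
    open ℕ.≤-Reasoning
    d′u : ℕ
    d′u = degree H′ u
    d′u+s≡du : d′u ℕ.+ s ≡ degree H u
    d′u+s≡du = ≡.trans (≡.cong (d′u ℕ.+_) (≡.sym (ΣN.indicator-true (u Fin.≟ u) ≡.refl)))
      (≡.trans (degree-balance u) (≡.trans (≡.cong (degree H u ℕ.+_) (ΣN.indicator-false (u Fin.≟ v) u≢v)) (ℕ.+-identityʳ _)))
    -- Cancelling s in d′(u) + s = d(u) < d(v) + s.
    d′u<dv : d′u ℕ.< degree H v
    d′u<dv = ℕ.+-cancelʳ-< s d′u (degree H v) (≡.subst (ℕ._< degree H v ℕ.+ s) (≡.sym d′u+s≡du) du<dv+s)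

  -- Some edge is moved; it has k vertices and misses v, hence is not the whole vertex set.
  order-bound : 1 ℕ.≤ s → k ℕ.< n
  order-bound 1≤s with pendantsAt H u in eq
  order-bound () | []
  ... | e ∷ _ with ∈-filter⁻ moved? {xs = edges H} (≡.subst (e ∈_) (≡.sym eq) (here ≡.refl))
  ...   | e∈H , moved-e@(u∈e , _) = ≡.subst (ℕ._< n) ∣e∣≡k (ℕ.≤∧≢⇒< (∣p∣≤n e) λ ∣e∣≡n →
            v∉e u∈e ∣e∣≡k ∣me∣≡k (≡.subst (v Subset.∈_) (≡.sym (∣p∣≡n⇒p≡⊤ ∣e∣≡n)) ∈⊤))
    where
    ∣e∣≡k : ∣ e ∣ ≡ k
    ∣e∣≡k = All.lookup (uniform H) e∈H
    ∣me∣≡k : ∣ move H u v e ∣ ≡ k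
    ∣me∣≡k = ≡.trans (≡.cong (λ b → ∣ if b then move H u v e else e ∣) (≡.sym (dec-true (moved? e) moved-e)))
      (All.lookup uniform-moved e∈H)

-- Polynomial expressions and their derivations

module TracePolynomials {c ℓ₁ ℓ₂} (F : OrderedField c ℓ₁ ℓ₂) where

  open OrderedField F hiding (zero) renaming (_-_ to _−_)
  open Traces F

  eval₀ : ∀ {n} → Poly n → Carrier
  eval₀ = eval (λ _ → 0#)

  ∂⋆ : ∀ {n} → List (Fin n × Fin n) → Poly n → Poly n
  ∂⋆ xs p = foldr ∂ p xs

  δ# : ∀ {n} → Fin n × Fin n → Fin n × Fin n → Carrier
  δ# x y = if does (≡-dec Fin._≟_ Fin._≟_ x y) then 1# else 0#

  δ#-≡ : ∀ {n} (x : Fin n × Fin n) → δ# x x ≡ 1#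
  δ#-≡ x = ≡.cong (if_then 1# else 0#) (dec-true (≡-dec Fin._≟_ Fin._≟_ x x) ≡.refl)

  δ#-≢ : ∀ {n} {x y : Fin n × Fin n} → x ≢ y → δ# x y ≡ 0#
  δ#-≢ {x = x} {y} x≢y = ≡.cong (if_then 1# else 0#) (dec-false (≡-dec Fin._≟_ Fin._≟_ x y) x≢y)

  -- Equality of polynomials modulo the indeterminates outside V. It is
  -- preserved by the derivations along V, which is what allows a trace to be
  -- simplified before it is differentiated.
  module Congruence {n : ℕ} (V : Fin n × Fin n → Set) where

    infix 4 _≃_

    -- Generated inductively because agreement of values at 0 is not respected by derivations,
    -- whereas `∂-cong` can follow a derivation of p ≃ q rule by rule.
    data _≃_ : Poly n → Poly n → Set (c ⊔ ℓ₁) where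
      ≃-refl       : ∀ {p} → p ≃ p
      ≃-sym        : ∀ {p q} → p ≃ q → q ≃ p
      ≃-trans      : ∀ {p q r} → p ≃ q → q ≃ r → p ≃ r
      :+-cong      : ∀ {p p′ q q′} → p ≃ p′ → q ≃ q′ → p :+ q ≃ p′ :+ q′
      :*-cong      : ∀ {p p′ q q′} → p ≃ p′ → q ≃ q′ → p :* q ≃ p′ :* q′
      :+-assoc     : ∀ p q r → (p :+ q) :+ r ≃ p :+ (q :+ r)
      :+-comm      : ∀ p q → p :+ q ≃ q :+ p
      :+-identityˡ : ∀ p → con 0# :+ p ≃ p
      :*-assoc     : ∀ p q r → (p :* q) :* r ≃ p :* (q :* r)
      :*-comm      : ∀ p q → p :* q ≃ q :* p
      :*-identityˡ : ∀ p → con 1# :* p ≃ p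
      :*-distribʳ  : ∀ r p q → (p :+ q) :* r ≃ (p :* r) :+ (q :* r)
      :*-zeroˡ     : ∀ p → con 0# :* p ≃ con 0#
      con-cong     : ∀ {a b} → a ≈ b → con a ≃ con b
      con-+        : ∀ a b → con a :+ con b ≃ con (a + b)
      con-*        : ∀ a b → con a :* con b ≃ con (a * b)
      null         : ∀ {x} → ¬ V x → var x ≃ con 0#

    polySemiring : CommutativeSemiring c (c ⊔ ℓ₁)
    polySemiring = record
      { Carrier = Poly n ; _≈_ = _≃_ ; _+_ = _:+_ ; _*_ = _:*_ ; 0# = con 0# ; 1# = con 1#
      ; isCommutativeSemiring = IsCommutativeSemiringˡ.isCommutativeSemiring record
        { +-isCommutativeMonoid = record
          { isMonoid = record
            { isSemigroup = record
              { isMagma = record { isEquivalence = equiv ; ∙-cong = :+-cong } ; assoc = :+-assoc }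
            ; identity = :+-identityˡ , λ p → ≃-trans (:+-comm p _) (:+-identityˡ p) }
          ; comm = :+-comm }
        ; *-isCommutativeMonoid = record
          { isMonoid = record
            { isSemigroup = record
              { isMagma = record { isEquivalence = equiv ; ∙-cong = :*-cong } ; assoc = :*-assoc }
            ; identity = :*-identityˡ , λ p → ≃-trans (:*-comm p _) (:*-identityˡ p) }
          ; comm = :*-comm }
        ; distribʳ = :*-distribʳ
        ; zeroˡ = :*-zeroˡ
        } }
      where
      equiv : IsEquivalence _≃_
      equiv = record { refl = ≃-refl ; sym = ≃-sym ; trans = ≃-trans }

    module P = CommutativeSemiring polySemiring
    open P using () renaming (+-commutativeMonoid to polyMonoid)
    -- In this monoid `sum` unfolds to the same fold as `∑`, so the lemmas on finite sums apply to
    -- `∑` as they stand.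
    open ListSum polyMonoid public
    open SetoidReasoning P.setoid
    open NaturalCoefficients polySemiring using (solve; _:=_) renaming (_:+_ to _⊕_; _:*_ to _⊗_; con to κ)

    eval₀-cong : ∀ {p q} → p ≃ q → eval₀ p ≈ eval₀ q
    eval₀-cong ≃-refl             = refl
    eval₀-cong (≃-sym e)          = sym (eval₀-cong e)
    eval₀-cong (≃-trans e e′)     = trans (eval₀-cong e) (eval₀-cong e′)
    eval₀-cong (:+-cong e e′)     = +-cong (eval₀-cong e) (eval₀-cong e′)
    eval₀-cong (:*-cong e e′)     = *-cong (eval₀-cong e) (eval₀-cong e′)
    eval₀-cong (:+-assoc p q r)   = +-assoc _ _ _
    eval₀-cong (:+-comm p q)      = +-comm _ _
    eval₀-cong (:+-identityˡ p)   = +-identityˡ _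
    eval₀-cong (:*-assoc p q r)   = *-assoc _ _ _
    eval₀-cong (:*-comm p q)      = *-comm _ _
    eval₀-cong (:*-identityˡ p)   = *-identityˡ _
    eval₀-cong (:*-distribʳ r p q) = distribʳ _ _ _
    eval₀-cong (:*-zeroˡ p)       = zeroˡ _
    eval₀-cong (con-cong e)       = e
    eval₀-cong (con-+ a b)        = refl
    eval₀-cong (con-* a b)        = refl
    eval₀-cong (null ¬Vx)         = refl

    -- The semiring rules follow from the Leibniz rule. For `null` the condition on x matters: an
    -- indeterminate outside V differs from x, so its derivative is 0.
    ∂-cong : ∀ {x p q} → V x → p ≃ q → ∂ x p ≃ ∂ x q
    ∂-cong Vx ≃-refl         = ≃-refl
    ∂-cong Vx (≃-sym e)      = ≃-sym (∂-cong Vx e)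
    ∂-cong Vx (≃-trans e e′) = ≃-trans (∂-cong Vx e) (∂-cong Vx e′)
    ∂-cong Vx (:+-cong e e′) = :+-cong (∂-cong Vx e) (∂-cong Vx e′)
    ∂-cong Vx (:*-cong e e′) = :+-cong (:*-cong (∂-cong Vx e) e′) (:*-cong e (∂-cong Vx e′))
    ∂-cong Vx (:+-assoc p q r) = :+-assoc _ _ _
    ∂-cong Vx (:+-comm p q)    = :+-comm _ _
    ∂-cong Vx (:+-identityˡ p) = :+-identityˡ _
    ∂-cong Vx (:*-assoc p q r) =
      solve 6 (λ p p′ q q′ r r′ → (p′ ⊗ q ⊕ p ⊗ q′) ⊗ r ⊕ (p ⊗ q) ⊗ r′ := p′ ⊗ (q ⊗ r) ⊕ p ⊗ (q′ ⊗ r ⊕ q ⊗ r′))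
        ≃-refl p (∂ _ p) q (∂ _ q) r (∂ _ r)
    ∂-cong Vx (:*-comm p q)    =
      solve 4 (λ p p′ q q′ → p′ ⊗ q ⊕ p ⊗ q′ := q′ ⊗ p ⊕ q ⊗ p′) ≃-refl p (∂ _ p) q (∂ _ q)
    ∂-cong Vx (:*-identityˡ p) =
      solve 2 (λ p p′ → κ 0 ⊗ p ⊕ κ 1 ⊗ p′ := p′) ≃-refl p (∂ _ p)
    ∂-cong Vx (:*-distribʳ r p q) =
      solve 6 (λ p p′ q q′ r r′ → (p′ ⊕ q′) ⊗ r ⊕ (p ⊕ q) ⊗ r′ := (p′ ⊗ r ⊕ p ⊗ r′) ⊕ (q′ ⊗ r ⊕ q ⊗ r′))
        ≃-refl p (∂ _ p) q (∂ _ q) r (∂ _ r)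
    ∂-cong Vx (:*-zeroˡ p) =
      solve 2 (λ p p′ → κ 0 ⊗ p ⊕ κ 0 ⊗ p′ := κ 0) ≃-refl p (∂ _ p)
    ∂-cong Vx (con-cong e) = ≃-refl
    ∂-cong Vx (con-+ a b)  = :+-identityˡ _
    ∂-cong Vx (con-* a b)  = ≃-trans (:+-cong (:*-zeroˡ _) (≃-trans (:*-comm _ _) (:*-zeroˡ _))) (:+-identityˡ _)
    ∂-cong {x} Vx (null {y} ¬Vy) = con-cong (reflexive (δ#-≢ (λ x≡y → ¬Vy (≡.subst V x≡y Vx))))

    ∂-scale : ∀ x a p → ∂ x (con a :* p) ≃ con a :* ∂ x p
    ∂-scale x a p = ≃-trans (:+-cong (:*-zeroˡ p) ≃-refl) (:+-identityˡ _)

    ∂-∑ : ∀ x (xs : List A) (f : A → Poly n) → ∂ x (∑ xs f) ≡ ∑ xs (∂ x ∘ f)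
    ∂-∑ x []       f = ≡.refl
    ∂-∑ x (y ∷ ys) f = ≡.cong (∂ x (f y) :+_) (∂-∑ x ys f)

    ∂-swap : ∀ x y p → ∂ x (∂ y p) ≃ ∂ y (∂ x p)
    ∂-swap x y (con a)  = ≃-refl
    ∂-swap x y (var z)  = ≃-refl
    ∂-swap x y (p :+ q) = :+-cong (∂-swap x y p) (∂-swap x y q)
    ∂-swap x y (p :* q) = begin
      (∂ x (∂ y p) :* q :+ ∂ y p :* ∂ x q) :+ (∂ x p :* ∂ y q :+ p :* ∂ x (∂ y q))
        ≈⟨ :+-cong (:+-cong (:*-cong (∂-swap x y p) ≃-refl) ≃-refl) (:+-cong ≃-refl (:*-cong ≃-refl (∂-swap x y q))) ⟩
      (∂ y (∂ x p) :* q :+ ∂ y p :* ∂ x q) :+ (∂ x p :* ∂ y q :+ p :* ∂ y (∂ x q))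
        ≈⟨ P.+-assoc _ _ _ ⟩
      ∂ y (∂ x p) :* q :+ (∂ y p :* ∂ x q :+ (∂ x p :* ∂ y q :+ p :* ∂ y (∂ x q)))
        ≈⟨ :+-cong ≃-refl (≃-trans (≃-sym (P.+-assoc _ _ _)) (≃-trans (:+-cong (:+-comm _ _) ≃-refl) (P.+-assoc _ _ _))) ⟩
      ∂ y (∂ x p) :* q :+ (∂ x p :* ∂ y q :+ (∂ y p :* ∂ x q :+ p :* ∂ y (∂ x q)))
        ≈⟨ P.+-assoc _ _ _ ⟨
      (∂ y (∂ x p) :* q :+ ∂ x p :* ∂ y q) :+ (∂ y p :* ∂ x q :+ p :* ∂ y (∂ x q)) ∎

    ∂⋆-cong : ∀ {xs p q} → All V xs → p ≃ q → ∂⋆ xs p ≃ ∂⋆ xs q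
    ∂⋆-cong []         e = e
    ∂⋆-cong (Vx ∷ Vxs) e = ∂-cong Vx (∂⋆-cong Vxs e)

    ∂⋆-zero : ∀ (xs : List (Fin n × Fin n)) → ∂⋆ xs (con 0#) ≡ con 0#
    ∂⋆-zero []       = ≡.refl
    ∂⋆-zero (x ∷ xs) = ≡.cong (∂ x) (∂⋆-zero xs)

    ∂-∂⋆-swap : ∀ x {xs} p → All V xs → ∂ x (∂⋆ xs p) ≃ ∂⋆ xs (∂ x p)
    ∂-∂⋆-swap x p []         = ≃-refl
    ∂-∂⋆-swap x p (Vy ∷ Vxs) = ≃-trans (∂-swap x _ _) (∂-cong Vy (∂-∂⋆-swap x p Vxs))

    ∂⋆-scale : ∀ {xs} a p → All V xs → ∂⋆ xs (con a :* p) ≃ con a :* ∂⋆ xs p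
    ∂⋆-scale a p []         = ≃-refl
    ∂⋆-scale a p (Vx ∷ Vxs) = ≃-trans (∂-cong Vx (∂⋆-scale a p Vxs)) (∂-scale _ a _)

    ∂⋆-∑ : ∀ xs (ys : List A) (f : A → Poly n) → ∂⋆ xs (∑ ys f) ≡ ∑ ys (∂⋆ xs ∘ f)
    ∂⋆-∑ []       ys f = ≡.refl
    ∂⋆-∑ (x ∷ xs) ys f = ≡.trans (≡.cong (∂ x) (∂⋆-∑ xs ys f)) (∂-∑ x ys _)

    -- Derivations commute, so the one along x can be moved innermost, where it meets p.
    ∂⋆-annihilates : ∀ {x xs p} → All V xs → x ∈ xs → ∂ x p ≃ con 0# → ∂⋆ xs p ≃ con 0#
    ∂⋆-annihilates {xs = _ ∷ xs} (Vx ∷ Vxs) (here ≡.refl) e =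
      ≃-trans (∂-∂⋆-swap _ _ Vxs) (≃-trans (∂⋆-cong Vxs e) (P.reflexive (∂⋆-zero xs)))
    ∂⋆-annihilates (Vy ∷ Vxs) (there x∈xs) e = ∂-cong Vy (∂⋆-annihilates Vxs x∈xs e)

  -- Derivatives of traces of matrix powers

  module F = CommutativeRing commutativeRing
  open SemiringMult F.semiring using (×-homo-+)

  fromℕ-+ : ∀ m n → fromℕ (m ℕ.+ n) ≈ fromℕ m + fromℕ n
  fromℕ-+ m n = ×-homo-+ 1# m n

  fromℕ-* : ∀ m n → fromℕ (m ℕ.* n) ≈ fromℕ m * fromℕ n
  fromℕ-* zero    n = sym (zeroˡ _)
  fromℕ-* (suc m) n = begin
    fromℕ (n ℕ.+ m ℕ.* n)              ≈⟨ fromℕ-+ n (m ℕ.* n) ⟩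
    fromℕ n + fromℕ (m ℕ.* n)          ≈⟨ +-cong (sym (*-identityˡ _)) (fromℕ-* m n) ⟩
    1# * fromℕ n + fromℕ m * fromℕ n   ≈⟨ distribʳ _ _ _ ⟨
    (1# + fromℕ m) * fromℕ n           ∎
    where open SetoidReasoning F.setoid

  -- No indeterminate of V lies in row l, so no closed walk along V passes through l.
  module Avoiding {n} {V : Fin n × Fin n → Set} {l : Fin n} (V-avoids-l : ∀ {x} → V x → proj₁ x ≢ l) where

    open Congruence V

    A^-row : ∀ N b → A^ (suc N) l b ≃ con 0#
    A^-row N b = sum-zero (allFin n) λ c →
      ≃-trans (:*-cong (null (λ Vx → V-avoids-l Vx ≡.refl)) ≃-refl) (:*-zeroˡ _)

    -- A walk that has used the arc (i , l) stands at l. As row l is null it cannot leave again, so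
    -- it would have to end at l and not at b.
    ∂A^-column : ∀ i N a {b} → b ≢ l → ∂ (i , l) (A^ N a b) ≃ con 0#
    ∂A^-column i zero    a b≢l = ≃-refl
    ∂A^-column i (suc N) a {b} b≢l = ≃-trans (P.reflexive (∂-∑ (i , l) (allFin n) _)) (sum-zero (allFin n) λ c →
      ≃-trans (:+-cong (edge c) (≃-trans (:*-cong ≃-refl (∂A^-column i N c b≢l)) (P.zeroʳ _))) (:+-identityˡ _))
      where
      return : ∀ N → A^ N l b ≃ con 0#
      return zero    = con-cong (reflexive (≡.cong (if_then 1# else 0#) (dec-false (l Fin.≟ b) (≡.≢-sym b≢l))))
      return (suc N) = A^-row N b

      edge : ∀ c → con (δ# (i , l) (a , c)) :* A^ N c b ≃ con 0#
      edge c with ≡-dec Fin._≟_ Fin._≟_ (i , l) (a , c)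
      ... | yes ≡.refl = ≃-trans (:*-identityˡ _) (return N)
      ... | no _       = :*-zeroˡ _

    -- Closed walks based at l are null from their first arc on, even before differentiation; those
    -- based elsewhere end away from l and fall under `∂A^-column`.
    ∂trA^-column : ∀ i N → V (i , l) → ∂ (i , l) (trA^ (suc N)) ≃ con 0#
    ∂trA^-column i N Vx = ≃-trans (P.reflexive (∂-∑ (i , l) (allFin n) _)) (sum-zero (allFin n) term)
      where
      term : ∀ a → ∂ (i , l) (A^ (suc N) a a) ≃ con 0#
      term a with a Fin.≟ l
      ... | yes ≡.refl = ∂-cong Vx (A^-row N l)
      ... | no a≢l     = ∂A^-column i (suc N) a a≢l

  -- V is taken to be all arcs whose source is not l. Every derivation in xs is then along V, so
  -- passing to the congruence loses nothing.
  eval₀-trA^-avoiding : ∀ {n} {i l : Fin n} {xs} N → All ((_≢ l) ∘ proj₁) xs → (i , l) ∈ xs →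
                        eval₀ (∂⋆ xs (trA^ (suc N))) ≈ 0#
  eval₀-trA^-avoiding {i = i} N xs≢l il∈xs =
    eval₀-cong (∂⋆-annihilates xs≢l il∈xs (∂trA^-column i N (All.lookup xs≢l il∈xs)))
    where
    open Avoiding id
    open Congruence _

  pow : ∀ {n} → Poly n → ℕ → Poly n
  pow p zero    = con 1#
  pow p (suc N) = p :* pow p N

  module Diagonal {n : ℕ} where

    IsDiagonal : Fin n × Fin n → Set
    IsDiagonal (i , j) = i ≡ j

    open Congruence IsDiagonal
    open SetoidReasoning P.setoid
    open NaturalCoefficients polySemiring using (solve; _:=_) renaming (_:+_ to _⊕_; _:*_ to _⊗_; con to κ)

    -- Modulo the off-diagonal indeterminates the generic matrix is diagonal, so its powers are
    -- taken entrywise.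
    A^-diagonal : ∀ N a → A^ N a a ≃ pow (var (a , a)) N
    A^-offDiagonal : ∀ N {a b} → a ≢ b → A^ N a b ≃ con 0#

    A^-diagonal zero    a = con-cong (reflexive (≡.cong (if_then 1# else 0#) (dec-true (a Fin.≟ a) ≡.refl)))
    A^-diagonal (suc N) a = ≃-trans
      (sum-allFin-single a (λ c c≢a → ≃-trans (:*-cong (null (≡.≢-sym c≢a)) ≃-refl) (:*-zeroˡ _)))
      (:*-cong ≃-refl (A^-diagonal N a))

    A^-offDiagonal zero    {a} {b} a≢b = con-cong (reflexive (≡.cong (if_then 1# else 0#) (dec-false (a Fin.≟ b) a≢b)))
    A^-offDiagonal (suc N) {a} a≢b = ≃-trans
      (sum-allFin-single a (λ c c≢a → ≃-trans (:*-cong (null (≡.≢-sym c≢a)) ≃-refl) (:*-zeroˡ _)))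
      (≃-trans (:*-cong ≃-refl (A^-offDiagonal N a≢b)) (P.zeroʳ _))

    ∂-pow : ∀ x p N → ∂ x (pow p (suc N)) ≃ con (fromℕ (suc N)) :* (pow p N :* ∂ x p)
    ∂-pow x p zero    = ≃-trans (solve 2 (λ p p′ → p′ ⊗ κ 1 ⊕ p ⊗ κ 0 := κ 1 ⊗ (κ 1 ⊗ p′)) ≃-refl p (∂ x p))
      (:*-cong (con-cong (sym (+-identityʳ 1#))) ≃-refl)
    ∂-pow x p (suc N) = begin
      ∂ x p :* (p :* pow p N) :+ p :* ∂ x (pow p (suc N))
        ≈⟨ :+-cong ≃-refl (:*-cong ≃-refl (∂-pow x p N)) ⟩
      ∂ x p :* (p :* pow p N) :+ p :* (con (fromℕ (suc N)) :* (pow p N :* ∂ x p))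
        ≈⟨ solve 4 (λ p p′ q f → p′ ⊗ (p ⊗ q) ⊕ p ⊗ (f ⊗ (q ⊗ p′)) := (κ 1 ⊕ f) ⊗ ((p ⊗ q) ⊗ p′)) ≃-refl
             p (∂ x p) (pow p N) (con (fromℕ (suc N))) ⟩
      (con 1# :+ con (fromℕ (suc N))) :* ((p :* pow p N) :* ∂ x p)
        ≈⟨ :*-cong (con-+ _ _) ≃-refl ⟩
      con (fromℕ (suc (suc N))) :* ((p :* pow p N) :* ∂ x p) ∎

    ∂-pow-≡ : ∀ i N → ∂ (i , i) (pow (var (i , i)) (suc N)) ≃ con (fromℕ (suc N)) :* pow (var (i , i)) N
    ∂-pow-≡ i N = ≃-trans (∂-pow _ _ N) (:*-cong ≃-refl
      (≃-trans (:*-cong ≃-refl (con-cong (reflexive (δ#-≡ (i , i))))) (P.*-identityʳ _)))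

    ∂-pow-≢ : ∀ {i j} → i ≢ j → ∀ N → ∂ (i , i) (pow (var (j , j)) N) ≃ con 0#
    ∂-pow-≢ i≢j zero    = ≃-refl
    ∂-pow-≢ i≢j (suc N) = ≃-trans (∂-pow _ _ N) (≃-trans (:*-cong ≃-refl
      (≃-trans (:*-cong ≃-refl (con-cong (reflexive (δ#-≢ (i≢j ∘ ≡.cong proj₁))))) (P.zeroʳ _))) (P.zeroʳ _))

    ∂trA^ : ∀ i N → ∂ (i , i) (trA^ (suc N)) ≃ con (fromℕ (suc N)) :* pow (var (i , i)) N
    ∂trA^ i N = begin
      ∂ (i , i) (trA^ (suc N))                          ≡⟨ ∂-∑ (i , i) (allFin n) _ ⟩
      ∑ (allFin n) (λ a → ∂ (i , i) (A^ (suc N) a a))   ≈⟨ sum-cong (allFin n) (λ a → ∂-cong ≡.refl (A^-diagonal (suc N) a)) ⟩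
      ∑ (allFin n) (λ a → ∂ (i , i) (pow (var (a , a)) (suc N)))
                                                        ≈⟨ sum-allFin-single i (λ a a≢i → ∂-pow-≢ (≡.≢-sym a≢i) (suc N)) ⟩
      ∂ (i , i) (pow (var (i , i)) (suc N))             ≈⟨ ∂-pow-≡ i N ⟩
      con (fromℕ (suc N)) :* pow (var (i , i)) N        ∎

    ∂⋆-pow : ∀ i N → ∂⋆ (List.replicate N (i , i)) (pow (var (i , i)) N) ≃ con (fromℕ (N !))
    ∂⋆-pow i zero    = con-cong (sym (+-identityʳ 1#))
    ∂⋆-pow i (suc N) = begin
      ∂ (i , i) (∂⋆ (List.replicate N (i , i)) (pow (var (i , i)) (suc N))) ≈⟨ ∂-∂⋆-swap _ _ diag ⟩
      ∂⋆ (List.replicate N (i , i)) (∂ (i , i) (pow (var (i , i)) (suc N))) ≈⟨ ∂⋆-cong diag (∂-pow-≡ i N) ⟩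
      ∂⋆ (List.replicate N (i , i)) (con (fromℕ (suc N)) :* pow (var (i , i)) N) ≈⟨ ∂⋆-scale _ _ diag ⟩
      con (fromℕ (suc N)) :* ∂⋆ (List.replicate N (i , i)) (pow (var (i , i)) N) ≈⟨ :*-cong ≃-refl (∂⋆-pow i N) ⟩
      con (fromℕ (suc N)) :* con (fromℕ (N !)) ≈⟨ con-* _ _ ⟩
      con (fromℕ (suc N) * fromℕ (N !))        ≈⟨ con-cong (fromℕ-* (suc N) (N !)) ⟨
      con (fromℕ (suc N !)) ∎
      where
      diag : All IsDiagonal (List.replicate N (i , i))
      diag = All.replicate⁺ N ≡.refl

    -- Only the summand a_{ii}^{N+1} of the trace contributes. The resulting factorial is the one
    -- that `recip!` in `∏∇` cancels.
    eval₀-trA^-power : ∀ i N → eval₀ (∂⋆ (List.replicate (suc N) (i , i)) (trA^ (suc N))) ≈ fromℕ (suc N !)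
    eval₀-trA^-power i N = eval₀-cong (begin
      ∂ (i , i) (∂⋆ (List.replicate N (i , i)) (trA^ (suc N))) ≈⟨ ∂-∂⋆-swap _ _ diag ⟩
      ∂⋆ (List.replicate N (i , i)) (∂ (i , i) (trA^ (suc N))) ≈⟨ ∂⋆-cong diag (∂trA^ i N) ⟩
      ∂⋆ (List.replicate N (i , i)) (con (fromℕ (suc N)) :* pow (var (i , i)) N) ≈⟨ ∂⋆-scale _ _ diag ⟩
      con (fromℕ (suc N)) :* ∂⋆ (List.replicate N (i , i)) (pow (var (i , i)) N) ≈⟨ :*-cong ≃-refl (∂⋆-pow i N) ⟩
      con (fromℕ (suc N)) :* con (fromℕ (N !)) ≈⟨ con-* _ _ ⟩
      con (fromℕ (suc N) * fromℕ (N !))        ≈⟨ con-cong (fromℕ-* (suc N) (N !)) ⟨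
      con (fromℕ (suc N !)) ∎)
      where
      diag : All IsDiagonal (List.replicate N (i , i))
      diag = All.replicate⁺ N ≡.refl

    -- Modulo off-diagonal indeterminates the trace is a sum of powers of single loops, so no
    -- monomial contains two different ones.
    eval₀-trA^-mixed : ∀ {i j} → i ≢ j → ∀ {xs ys} N → All IsDiagonal xs → All IsDiagonal ys →
                       (i , i) ∈ xs → (j , j) ∈ ys → eval₀ (∂⋆ xs (∂⋆ ys (trA^ (suc N)))) ≈ 0#
    eval₀-trA^-mixed {i} {j} i≢j N dxs dys ii∈xs jj∈ys = eval₀-cong
      (∂⋆-annihilates dxs ii∈xs (≃-trans (∂-∂⋆-swap _ _ dys) (∂⋆-annihilates dys jj∈ys (begin
        ∂ (j , j) (∂ (i , i) (trA^ (suc N)))                    ≈⟨ ∂-cong ≡.refl (∂trA^ i N) ⟩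
        ∂ (j , j) (con (fromℕ (suc N)) :* pow (var (i , i)) N)  ≈⟨ ∂-scale _ _ _ ⟩
        con (fromℕ (suc N)) :* ∂ (j , j) (pow (var (i , i)) N)  ≈⟨ :*-cong ≃-refl (∂-pow-≢ (≡.≢-sym i≢j) N) ⟩
        con (fromℕ (suc N)) :* con 0#                           ≈⟨ P.zeroʳ _ ⟩
        con 0#                                                  ∎))))

  -- Expansion of the trace operators over compositions

  module ΣF = ListSum F.+-commutativeMonoid

  eval₀-∑ : ∀ {n} (xs : List A) (f : A → Poly n) → eval₀ (∑ xs f) ≡ ΣF.sum xs (eval₀ ∘ f)
  eval₀-∑ []       f = ≡.refl
  eval₀-∑ (x ∷ xs) f = ≡.cong (eval₀ (f x) +_) (eval₀-∑ xs f)

  module Full {N : ℕ} where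

    open Congruence {N} (λ _ → ⊤) public
    open SetoidReasoning P.setoid

    eval₀-pairSum : ∀ n (f : Fin n → Fin n → Poly N) → eval₀ (pairSum n f) ≡ ΣF.pairSum n (λ i j → eval₀ (f i j))
    eval₀-pairSum zero    f = ≡.refl
    eval₀-pairSum (suc n) f = ≡.cong₂ _+_ (eval₀-∑ (allFin n) _) (eval₀-pairSum n _)

    A^1 : ∀ (a b : Fin N) → A^ 1 a b ≃ var (a , b)
    A^1 a b = ≃-trans
      (sum-allFin-single b λ c c≢b → ≃-trans
        (:*-cong ≃-refl (con-cong (reflexive (≡.cong (if_then 1# else 0#) (dec-false (c Fin.≟ b) c≢b))))) (P.zeroʳ _))
      (≃-trans (:*-cong ≃-refl (con-cong (reflexive (≡.cong (if_then 1# else 0#) (dec-true (b Fin.≟ b) ≡.refl))))) (P.*-identityʳ _))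

    trA^2 : trA^ 2 ≃ ∑ (allFin N) λ a → ∑ (allFin N) λ b → var (a , b) :* var (b , a)
    trA^2 = sum-cong (allFin N) λ a → sum-cong (allFin N) λ b → :*-cong ≃-refl (A^1 b a)

    private
      δ-first : ∀ {x y : Fin N} {p : Fin N → Fin N → Poly N} →
                (∑ (allFin N) λ a → ∑ (allFin N) λ b → con (δ# (x , y) (a , b)) :* p a b) ≃ p x y
      δ-first {x} {y} {p} = ≃-trans
        (sum-allFin-single x λ a a≢x → sum-zero (allFin N) λ b → off (a≢x ∘ ≡.sym ∘ ≡.cong proj₁)) (≃-trans
        (sum-allFin-single y λ b b≢y → off (b≢y ∘ ≡.sym ∘ ≡.cong proj₂))
        (≃-trans (:*-cong (con-cong (reflexive (δ#-≡ (x , y)))) ≃-refl) (:*-identityˡ _)))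
        where
        off : ∀ {z q} → (x , y) ≢ z → con (δ# (x , y) z) :* q ≃ con 0#
        off xy≢z = ≃-trans (:*-cong (con-cong (reflexive (δ#-≢ xy≢z))) ≃-refl) (:*-zeroˡ _)

    -- The closed walk along (i , j) and back occurs in the trace once for each factor that the
    -- derivation can hit, hence the two copies.
    ∂trA^2 : ∀ i j → ∂ (i , j) (trA^ 2) ≃ var (j , i) :+ var (j , i)
    ∂trA^2 i j = begin
      ∂ (i , j) (trA^ 2)
        ≈⟨ ∂-cong tt trA^2 ⟩
      ∂ (i , j) (∑ (allFin N) λ a → ∑ (allFin N) λ b → var (a , b) :* var (b , a))
        ≡⟨ ∂-∑ (i , j) (allFin N) _ ⟩
      (∑ (allFin N) λ a → ∂ (i , j) (∑ (allFin N) λ b → var (a , b) :* var (b , a)))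
        ≈⟨ sum-cong (allFin N) (λ a → ≃-trans (P.reflexive (∂-∑ (i , j) (allFin N) _)) (sum-∙ (allFin N) _ _)) ⟩
      (∑ (allFin N) λ a → (∑ (allFin N) λ b → con (δ# (i , j) (a , b)) :* var (b , a))
                        :+ (∑ (allFin N) λ b → var (a , b) :* con (δ# (i , j) (b , a))))
        ≈⟨ sum-∙ (allFin N) _ _ ⟩
      (∑ (allFin N) λ a → ∑ (allFin N) λ b → con (δ# (i , j) (a , b)) :* var (b , a)) :+
      (∑ (allFin N) λ a → ∑ (allFin N) λ b → var (a , b) :* con (δ# (i , j) (b , a)))
        ≈⟨ :+-cong δ-first (≃-trans (sum-comm (allFin N) (allFin N) _) (≃-trans
             (sum-cong (allFin N) λ b → sum-cong (allFin N) λ a → :*-comm _ _) δ-first)) ⟩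
      var (j , i) :+ var (j , i) ∎

    eval₀-trA^2 : ∀ i l j l′ → eval₀ (∂ (i , l) (∂ (j , l′) (trA^ 2))) ≈ δ# (i , l) (l′ , j) + δ# (i , l) (l′ , j)
    eval₀-trA^2 i l j l′ = eval₀-cong (∂-cong tt (∂trA^2 j l′))

    -- The shape of `∏∇` for arbitrary operators. The index set of the operators is independent of
    -- that of the indeterminates, so induction on n can drop an operator while the polynomials stay
    -- the same.
    composite : ∀ {n} → (Fin n → ℕ → Poly N → Poly N) → Vec ℕ n → Poly N → Poly N
    composite D ds p = foldr (λ i q → D i (Vec.lookup ds i) q) p (allFin _)

    composite-∷ : ∀ {n} (D : Fin (suc n) → ℕ → Poly N → Poly N) d ds p →
                  composite D (d ∷ ds) p ≡ D zero d (composite (D ∘ suc) ds p)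
    composite-∷ {n} D d ds p = ≡.trans (≡.cong (foldr step p) (allFin-suc n))
      (≡.cong (D zero d) (List.foldr-map step suc p (allFin n)))
      where
      step : Fin (suc n) → Poly N → Poly N
      step i q = D i (Vec.lookup (d ∷ ds) i) q

    compositions-0 : ∀ n → compositions n 0 ≡ [ Vec.replicate n 0 ]
    compositions-0 zero = ≡.refl
    compositions-0 (suc n) rewrite compositions-0 n = ≡.refl

    Congruent : (Poly N → Poly N) → Set _
    Congruent g = ∀ {p q} → p ≃ q → g p ≃ g q

    -- The operator of exponent 0 is the identity only up to `≃`, because `∏∇` still multiplies by
    -- the inverse of 0!.
    record IsOperatorFamily {n} (D : Fin n → ℕ → Poly N → Poly N) : Set (c ⊔ ℓ₁) where
      field
        D-cong : ∀ i d → Congruent (D i d)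
        D-zero : ∀ i p → D i 0 p ≃ p

    tailFamily : ∀ {n} {D : Fin (suc n) → ℕ → Poly N → Poly N} → IsOperatorFamily D → IsOperatorFamily (D ∘ suc)
    tailFamily isFam = record { D-cong = D-cong ∘ suc ; D-zero = D-zero ∘ suc }
      where open IsOperatorFamily isFam

    composite-zero : ∀ {n} {D : Fin n → ℕ → Poly N → Poly N} → IsOperatorFamily D → ∀ p →
                     composite D (Vec.replicate n 0) p ≃ p
    composite-zero {zero}      isFam p = ≃-refl
    composite-zero {suc n} {D} isFam p = ≃-trans (P.reflexive (composite-∷ D 0 _ p))
      (≃-trans (D-zero zero _) (composite-zero (tailFamily isFam) p))
      where open IsOperatorFamily isFam

    private
      sum-∷ : ∀ {n} (D : Fin (suc n) → ℕ → Poly N → Poly N) {g} → Congruent g → ∀ d (dss : List (Vec ℕ n)) p →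
              (∑ (map (d ∷_) dss) λ ds → g (composite D ds p)) ≃ ∑ dss λ ds → g (D zero d (composite (D ∘ suc) ds p))
      sum-∷ D g-cong d dss p = ≃-trans (P.reflexive (sum-map (d ∷_) dss))
        (sum-cong dss λ ds → g-cong (P.reflexive (composite-∷ D d ds p)))

    sum-compositions-0 : ∀ {n} {D : Fin n → ℕ → Poly N → Poly N} → IsOperatorFamily D → ∀ {g} → Congruent g → ∀ p →
                         (∑ (compositions n 0) λ ds → g (composite D ds p)) ≃ g p
    sum-compositions-0 {n} isFam g-cong p rewrite compositions-0 n =
      ≃-trans (P.+-identityʳ _) (g-cong (composite-zero isFam p))

    -- The context g stands for operators already applied outside: `sum-compositions-2` uses the
    -- lemma with g = `D zero 1`, to form the pairs that contain `zero`.
    sum-compositions-1 : ∀ {n} {D : Fin n → ℕ → Poly N → Poly N} → IsOperatorFamily D → ∀ {g} → Congruent g → ∀ p →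
                         (∑ (compositions n 1) λ ds → g (composite D ds p)) ≃ ∑ (allFin n) λ i → g (D i 1 p)
    sum-compositions-1 {zero}      isFam         g-cong p = ≃-refl
    sum-compositions-1 {suc n} {D} isFam {g} g-cong p = begin
      (∑ (compositions (suc n) 1) λ ds → g (composite D ds p))
        ≈⟨ sum-concatMap (λ d → map (d ∷_) (compositions n (1 ℕ.∸ d))) (upTo 2) ⟩
      -- The summands with first entry 0 and 1, and the empty rest of `upTo 2`.
      _ :+ (_ :+ con 0#)
        ≈⟨ :+-cong (≃-trans (sum-∷ D g-cong 0 (compositions n 1) p) (≃-trans
                     (sum-cong (compositions n 1) (λ ds → g-cong (D-zero zero _)))
                     (sum-compositions-1 (tailFamily isFam) g-cong p)))
           (≃-trans (P.+-identityʳ _) (≃-trans (sum-∷ D g-cong 1 (compositions n 0) p)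
                     (sum-compositions-0 (tailFamily isFam) {g ∘ D zero 1} (g-cong ∘ D-cong zero 1) p))) ⟩
      (∑ (allFin n) λ i → g (D (suc i) 1 p)) :+ g (D zero 1 p)
        ≈⟨ :+-comm _ _ ⟩
      g (D zero 1 p) :+ (∑ (allFin n) λ i → g (D (suc i) 1 p))
        ≡⟨ sum-allFin-suc (λ i → g (D i 1 p)) ⟨
      (∑ (allFin (suc n)) λ i → g (D i 1 p)) ∎
      where open IsOperatorFamily isFam

    -- By the first entry: 2 gives the square term of `zero`, 1 gives the pairs of `zero` with a
    -- later index, and 0 leaves the same problem for the remaining indices.
    sum-compositions-2 : ∀ {n} {D : Fin n → ℕ → Poly N → Poly N} → IsOperatorFamily D → ∀ p →
                         (∑ (compositions n 2) λ ds → composite D ds p) ≃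
                         (∑ (allFin n) λ i → D i 2 p) :+ pairSum n (λ i j → D i 1 (D j 1 p))
    sum-compositions-2 {zero}      isFam p = ≃-sym (:+-identityˡ _)
    sum-compositions-2 {suc n} {D} isFam p = begin
      (∑ (compositions (suc n) 2) λ ds → composite D ds p)
        ≈⟨ sum-concatMap (λ d → map (d ∷_) (compositions n (2 ℕ.∸ d))) (upTo 3) ⟩
      _ :+ (_ :+ (_ :+ con 0#))
        ≈⟨ :+-cong (≃-trans (sum-∷ D id 0 (compositions n 2) p) (≃-trans
                     (sum-cong (compositions n 2) (λ ds → D-zero zero _))
                     (sum-compositions-2 (tailFamily isFam) p)))
           (:+-cong (≃-trans (sum-∷ D id 1 (compositions n 1) p)
                     (sum-compositions-1 (tailFamily isFam) {D zero 1} (D-cong zero 1) p))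
           (≃-trans (P.+-identityʳ _) (≃-trans (sum-∷ D id 2 (compositions n 0) p)
                     (sum-compositions-0 (tailFamily isFam) {D zero 2} (D-cong zero 2) p)))) ⟩
      (s₂ :+ ps) :+ (s₁ :+ D zero 2 p)
        ≈⟨ solve 4 (λ a b c d → (a ⊕ b) ⊕ (c ⊕ d) ⊜ (d ⊕ a) ⊕ (c ⊕ b)) ≃-refl s₂ ps s₁ (D zero 2 p) ⟩
      (D zero 2 p :+ s₂) :+ (s₁ :+ ps)
        ≡⟨ ≡.cong (_:+ (s₁ :+ ps)) (sum-allFin-suc (λ i → D i 2 p)) ⟨
      (∑ (allFin (suc n)) λ i → D i 2 p) :+ pairSum (suc n) (λ i j → D i 1 (D j 1 p)) ∎
      where
      open IsOperatorFamily isFam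
      open CommutativeMonoidSolver P.+-commutativeMonoid using (solve; _⊕_; _⊜_)
      s₁ s₂ ps : Poly N
      s₁ = ∑ (allFin n) λ j → D zero 1 (D (suc j) 1 p)
      s₂ = ∑ (allFin n) λ i → D (suc i) 2 p
      ps = pairSum n λ i j → D (suc i) 1 (D (suc j) 1 p)

  -- The first two traces of a tensor

  recip-inverse : ∀ n .{{_ : ℕ.NonZero n}} → recip n * fromℕ n ≈ 1#
  recip-inverse (suc n) = trans (*-cong refl x≈x−0) (proj₁ (proj₂ inverse))
    where
    inverse = #⇒invertible (#-sym (<⇒# (fromℕ-pos n)))
    x≈x−0 : fromℕ (suc n) ≈ fromℕ (suc n) − 0#
    x≈x−0 = sym (trans (+-cong refl -0#≈0#) (+-identityʳ _))
      where open RingProperties F.ring using (-0#≈0#)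

  recip!-inverse : ∀ n → recip! n * fromℕ (n !) ≈ 1#
  recip!-inverse n = recip-inverse (n !) {{n ℕ.!≢0}}

  row : ∀ {n m} → Fin n → Vec (Fin n) m → List (Fin n × Fin n)
  row i γ = map (i ,_) (Vec.toList γ)

  ∂ᵞ-row : ∀ {n m} i (γ : Vec (Fin n) m) p → ∂ᵞ i γ p ≡ ∂⋆ (row i γ) p
  ∂ᵞ-row i []      p = ≡.refl
  ∂ᵞ-row i (j ∷ γ) p = ≡.cong (∂ (i , j)) (∂ᵞ-row i γ p)

  row-replicate : ∀ {n} m (i : Fin n) → row i (Vec.replicate m i) ≡ List.replicate m (i , i)
  row-replicate zero    i = ≡.refl
  row-replicate (suc m) i = ≡.cong (_ ∷_) (row-replicate m i)

  row-source : ∀ {n m} {P : Fin n → Set} {i} → P i → (γ : Vec (Fin n) m) → All (P ∘ proj₁) (row i γ)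
  row-source Pi []      = []
  row-source Pi (j ∷ γ) = Pi ∷ row-source Pi γ

  row-∈ : ∀ {n m} {i l : Fin n} (γ : Vec (Fin n) m) → l ∈ Vec.toList γ → (i , l) ∈ row i γ
  row-∈ {i = i} γ = ∈-map⁺ (i ,_)

  -- Supplies the vertex l at which a walk gets stuck when every prescribed arc leaves i.
  nonconstant : ∀ {n m} {i : Fin n} (γ : Vec (Fin n) m) → γ ≢ Vec.replicate m i → ∃[ l ] l ∈ Vec.toList γ × l ≢ i
  nonconstant         []      γ≢ = contradiction ≡.refl γ≢
  nonconstant {i = i} (j ∷ γ) γ≢ with j Fin.≟ i
  ... | no j≢i = j , here ≡.refl , j≢i
  ... | yes ≡.refl with nonconstant γ (γ≢ ∘ ≡.cong (i ∷_))
  ...   | l , l∈γ , l≢i = l , there l∈γ , l≢i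

  module _ {n : ℕ} (m′ : ℕ) (T : Tensor (suc (suc m′)) n) where

    open Full {n}
    open SetoidReasoning F.setoid

    private
      m k : ℕ
      m = suc m′
      k = suc m

    ∇-cong : ∀ i → Congruent (∇ k T i)
    ∇-cong i p≃q = sum-cong (tuples n m) λ γ → :*-cong ≃-refl (≃-trans (P.reflexive (∂ᵞ-row i γ _))
      (≃-trans (∂⋆-cong (All.universal _ (row i γ)) p≃q) (P.reflexive (≡.sym (∂ᵞ-row i γ _)))))

    iterate-∇-cong : ∀ i d → Congruent (iterate d (∇ k T i))
    iterate-∇-cong i zero    p≃q = p≃q
    iterate-∇-cong i (suc d) p≃q = ∇-cong i (iterate-∇-cong i d p≃q)

    factor : Fin n → ℕ → Poly n → Poly n
    factor i d p = con (recip! (d ℕ.* m)) :* iterate d (∇ k T i) p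

    factor-isOperatorFamily : IsOperatorFamily factor
    factor-isOperatorFamily = record
      { D-cong = λ i d p≃q → :*-cong ≃-refl (iterate-∇-cong i d p≃q)
      ; D-zero = λ i p → ≃-trans (:*-cong (con-cong recip!0≈1) ≃-refl) (:*-identityˡ p)
      }
      where
      recip!0≈1 : recip! 0 ≈ 1#
      recip!0≈1 = trans (sym (trans (*-cong refl (+-identityʳ 1#)) (*-identityʳ _))) (recip!-inverse 0)

    eval₀-∇ : ∀ i p → eval₀ (∇ k T i p) ≈ ΣF.sum (tuples n m) λ γ → T i γ * eval₀ (∂⋆ (row i γ) p)
    eval₀-∇ i p = trans (reflexive (eval₀-∑ (tuples n m) _)) (ΣF.sum-cong (tuples n m) λ γ →
      *-cong refl (reflexive (≡.cong eval₀ (∂ᵞ-row i γ p))))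

    eval₀-∂⋆-∇ : ∀ xs j p → eval₀ (∂⋆ xs (∇ k T j p)) ≈ ΣF.sum (tuples n m) λ δ → T j δ * eval₀ (∂⋆ xs (∂⋆ (row j δ) p))
    eval₀-∂⋆-∇ xs j p = begin
      eval₀ (∂⋆ xs (∇ k T j p))
        ≡⟨ ≡.cong eval₀ (∂⋆-∑ xs (tuples n m) _) ⟩
      eval₀ (∑ (tuples n m) λ δ → ∂⋆ xs (con (T j δ) :* ∂ᵞ j δ p))
        ≡⟨ eval₀-∑ (tuples n m) _ ⟩
      (ΣF.sum (tuples n m) λ δ → eval₀ (∂⋆ xs (con (T j δ) :* ∂ᵞ j δ p)))
        ≈⟨ ΣF.sum-cong (tuples n m) (λ δ → eval₀-cong (∂⋆-scale _ _ (All.universal _ xs))) ⟩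
      (ΣF.sum (tuples n m) λ δ → T j δ * eval₀ (∂⋆ xs (∂ᵞ j δ p)))
        ≈⟨ ΣF.sum-cong (tuples n m) (λ δ → *-cong refl (reflexive (≡.cong (eval₀ ∘ ∂⋆ xs) (∂ᵞ-row j δ p)))) ⟩
      (ΣF.sum (tuples n m) λ δ → T j δ * eval₀ (∂⋆ xs (∂⋆ (row j δ) p))) ∎

    -- The coefficient of T i γ * T j δ in Tr₂, up to a scalar factor.
    pairing : Fin n → Vec (Fin n) m → Fin n → Vec (Fin n) m → Carrier
    pairing i γ j δ = eval₀ (∂⋆ (row i γ) (∂⋆ (row j δ) (trA^ (2 ℕ.* m))))

    interaction : Fin n → Fin n → Carrier
    interaction i j = ΣF.sum (tuples n m) λ γ → T i γ * ΣF.sum (tuples n m) λ δ → T j δ * pairing i γ j δ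

    eval₀-∇∇ : ∀ i j → eval₀ (∇ k T i (∇ k T j (trA^ (2 ℕ.* m)))) ≈ interaction i j
    eval₀-∇∇ i j = trans (eval₀-∇ i _) (ΣF.sum-cong (tuples n m) λ γ → *-cong refl (eval₀-∂⋆-∇ (row i γ) j _))

    ∇-scale : ∀ i a p → ∇ k T i (con a :* p) ≃ con a :* ∇ k T i p
    ∇-scale i a p = ≃-trans (sum-cong (tuples n m) λ γ → ≃-trans (:*-cong ≃-refl (scale γ)) (swap γ)) (out (tuples n m))
      where
      scale : ∀ (γ : Vec (Fin n) m) → ∂ᵞ i γ (con a :* p) ≃ con a :* ∂ᵞ i γ p
      scale γ = ≃-trans (P.reflexive (∂ᵞ-row i γ _)) (≃-trans (∂⋆-scale a p (All.universal _ (row i γ)))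
        (:*-cong ≃-refl (P.reflexive (≡.sym (∂ᵞ-row i γ p)))))
      swap : ∀ γ → con (T i γ) :* (con a :* ∂ᵞ i γ p) ≃ con a :* (con (T i γ) :* ∂ᵞ i γ p)
      swap γ = ≃-trans (≃-sym (:*-assoc _ _ _)) (≃-trans (:*-cong (:*-comm _ _) ≃-refl) (:*-assoc _ _ _))
      out : ∀ (xs : List (Vec (Fin n) m)) {f} → (∑ xs λ x → con a :* f x) ≃ con a :* ∑ xs f
      out []       = ≃-sym (P.zeroʳ _)
      out (x ∷ xs) = ≃-trans (:+-cong ≃-refl (out xs)) (≃-sym (P.distribˡ _ _ _))

    diagonal : Fin n → Carrier
    diagonal i = T i (Vec.replicate m i)

    -- All arcs of a term leave the same i, so a γ with an entry l other than i contributes nothing;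
    -- for the constant γ the factorial cancels.
    Tr-1 : Tr k T 1 ≈ fromℕ (m ℕ.^ (n ℕ.∸ 1)) * ΣF.sum (allFin n) diagonal
    Tr-1 = *-cong refl (begin
      eval₀ (∑ (compositions n 1) λ ds → composite factor ds (trA^ (1 ℕ.* m)))
        ≈⟨ eval₀-cong (sum-compositions-1 factor-isOperatorFamily {id} id _) ⟩
      eval₀ (∑ (allFin n) λ i → factor i 1 (trA^ (1 ℕ.* m)))
        ≡⟨ eval₀-∑ (allFin n) _ ⟩
      (ΣF.sum (allFin n) λ i → recip! (1 ℕ.* m) * eval₀ (∇ k T i (trA^ (1 ℕ.* m))))
        ≈⟨ ΣF.sum-cong (allFin n) term ⟩
      ΣF.sum (allFin n) diagonal ∎)
      where
      power : ∀ i → eval₀ (∂⋆ (row i (Vec.replicate m i)) (trA^ (1 ℕ.* m))) ≈ fromℕ ((1 ℕ.* m) !)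
      power i = trans (reflexive (≡.cong (λ xs → eval₀ (∂⋆ xs (trA^ (1 ℕ.* m))))
          (≡.trans (row-replicate m i) (≡.cong (λ N → List.replicate N (i , i)) (≡.sym (ℕ.*-identityˡ m))))))
        -- The exponent `1 ℕ.* m` unfolds to `suc (m′ ℕ.+ 0)`; in the same way `2 ℕ.* m` is
        -- `suc (m′ ℕ.+ 1 ℕ.* m)` further on.
        (Diagonal.eval₀-trA^-power i (m′ ℕ.+ 0))

      term : ∀ i → recip! (1 ℕ.* m) * eval₀ (∇ k T i (trA^ (1 ℕ.* m))) ≈ diagonal i
      term i = begin
        recip! (1 ℕ.* m) * eval₀ (∇ k T i (trA^ (1 ℕ.* m)))
          ≈⟨ *-cong refl (eval₀-∇ i _) ⟩
        recip! (1 ℕ.* m) * (ΣF.sum (tuples n m) λ γ → T i γ * eval₀ (∂⋆ (row i γ) (trA^ (1 ℕ.* m))))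
          ≈⟨ *-cong refl (ΣF.sum-tuples-single (Vec.replicate m i) λ γ γ≢ → case nonconstant γ γ≢ of λ where
               (l , l∈γ , l≢i) → trans (*-cong refl (eval₀-trA^-avoiding (m′ ℕ.+ 0)
                 (row-source (≡.≢-sym l≢i) γ) (row-∈ γ l∈γ))) (F.zeroʳ _)) ⟩
        recip! (1 ℕ.* m) * (diagonal i * eval₀ (∂⋆ (row i (Vec.replicate m i)) (trA^ (1 ℕ.* m))))
          ≈⟨ *-cong refl (*-cong refl (power i)) ⟩
        recip! (1 ℕ.* m) * (diagonal i * fromℕ ((1 ℕ.* m) !))
          ≈⟨ *-cong refl (*-comm _ _) ⟩
        recip! (1 ℕ.* m) * (fromℕ ((1 ℕ.* m) !) * diagonal i)
          ≈⟨ *-assoc _ _ _ ⟨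
        recip! (1 ℕ.* m) * fromℕ ((1 ℕ.* m) !) * diagonal i
          ≈⟨ *-cong (recip!-inverse (1 ℕ.* m)) refl ⟩
        1# * diagonal i
          ≈⟨ *-identityˡ _ ⟩
        diagonal i ∎

    -- Joined into one list, the two rows contain only arcs leaving i or j, so a walk that enters l
    -- is stuck there.
    pairing-avoiding : ∀ {i j l} γ δ → i ≢ l → j ≢ l → l ∈ Vec.toList γ ⊎ l ∈ Vec.toList δ → pairing i γ j δ ≈ 0#
    pairing-avoiding {i} {j} {l} γ δ i≢l j≢l l∈ = trans
      (reflexive (≡.cong eval₀ (≡.sym (List.foldr-++ ∂ _ (row i γ) (row j δ)))))
      (vanishes l∈)
      where
      sources : All ((_≢ l) ∘ proj₁) (row i γ ++ row j δ)
      sources = All.++⁺ (row-source i≢l γ) (row-source j≢l δ)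
      vanishes : l ∈ Vec.toList γ ⊎ l ∈ Vec.toList δ → eval₀ (∂⋆ (row i γ ++ row j δ) (trA^ (2 ℕ.* m))) ≈ 0#
      vanishes (inj₁ l∈γ) = eval₀-trA^-avoiding (m′ ℕ.+ 1 ℕ.* m) sources (∈-++⁺ˡ (row-∈ γ l∈γ))
      vanishes (inj₂ l∈δ) = eval₀-trA^-avoiding (m′ ℕ.+ 1 ℕ.* m) sources (∈-++⁺ʳ (row i γ) (row-∈ δ l∈δ))

    interaction-self : ∀ i → interaction i i ≈ diagonal i * diagonal i * fromℕ ((2 ℕ.* m) !)
    interaction-self i = begin
      interaction i i
        ≈⟨ ΣF.sum-tuples-single (Vec.replicate m i) (λ γ γ≢ → case nonconstant γ γ≢ of λ where
             (l , l∈γ , l≢i) → trans (*-cong refl (ΣF.sum-zero (tuples n m) λ δ → trans (*-cong refl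
               (pairing-avoiding γ δ (≡.≢-sym l≢i) (≡.≢-sym l≢i) (inj₁ l∈γ))) (F.zeroʳ _))) (F.zeroʳ _)) ⟩
      diagonal i * (ΣF.sum (tuples n m) λ δ → T i δ * pairing i (Vec.replicate m i) i δ)
        ≈⟨ *-cong refl (ΣF.sum-tuples-single (Vec.replicate m i) λ δ δ≢ → case nonconstant δ δ≢ of λ where
             (l , l∈δ , l≢i) → trans (*-cong refl
               (pairing-avoiding (Vec.replicate m i) δ (≡.≢-sym l≢i) (≡.≢-sym l≢i) (inj₂ l∈δ))) (F.zeroʳ _)) ⟩
      diagonal i * (diagonal i * pairing i (Vec.replicate m i) i (Vec.replicate m i))
        ≈⟨ *-cong refl (*-cong refl power) ⟩
      diagonal i * (diagonal i * fromℕ ((2 ℕ.* m) !))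
        ≈⟨ *-assoc _ _ _ ⟨
      diagonal i * diagonal i * fromℕ ((2 ℕ.* m) !) ∎
      where
      rows : row i (Vec.replicate m i) ++ row i (Vec.replicate m i) ≡ List.replicate (2 ℕ.* m) (i , i)
      rows = ≡.trans (≡.cong₂ _++_ (row-replicate m i) (row-replicate m i))
        (≡.trans (replicate-+ m m) (≡.cong (λ N → List.replicate (m ℕ.+ N) (i , i)) (≡.sym (ℕ.+-identityʳ m))))
        where
        replicate-+ : ∀ p q → List.replicate p (i , i) ++ List.replicate q (i , i) ≡ List.replicate (p ℕ.+ q) (i , i)
        replicate-+ zero    q = ≡.refl
        replicate-+ (suc p) q = ≡.cong (_ ∷_) (replicate-+ p q)
      power : pairing i (Vec.replicate m i) i (Vec.replicate m i) ≈ fromℕ ((2 ℕ.* m) !)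
      power = trans (reflexive (≡.cong eval₀ (≡.trans
          (≡.sym (List.foldr-++ ∂ _ (row i (Vec.replicate m i)) (row i (Vec.replicate m i))))
          (≡.cong (λ xs → ∂⋆ xs (trA^ (2 ℕ.* m))) rows))))
        (Diagonal.eval₀-trA^-power i (m′ ℕ.+ 1 ℕ.* m))

    Tr-2 : Tr k T 2 ≈ fromℕ (m ℕ.^ (n ℕ.∸ 1)) *
      ((ΣF.sum (allFin n) λ i → diagonal i * diagonal i) +
       ΣF.pairSum n (λ i j → recip! (1 ℕ.* m) * (recip! (1 ℕ.* m) * interaction i j)))
    Tr-2 = *-cong refl (begin
      eval₀ (∑ (compositions n 2) λ ds → composite factor ds (trA^ (2 ℕ.* m)))
        ≈⟨ eval₀-cong (sum-compositions-2 factor-isOperatorFamily _) ⟩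
      eval₀ (∑ (allFin n) λ i → factor i 2 (trA^ (2 ℕ.* m))) +
      eval₀ (pairSum n λ i j → factor i 1 (factor j 1 (trA^ (2 ℕ.* m))))
        ≡⟨ ≡.cong₂ _+_ (eval₀-∑ (allFin n) _) (eval₀-pairSum n _) ⟩
      (ΣF.sum (allFin n) λ i → recip! (2 ℕ.* m) * eval₀ (∇ k T i (∇ k T i (trA^ (2 ℕ.* m))))) +
      ΣF.pairSum n (λ i j → eval₀ (factor i 1 (factor j 1 (trA^ (2 ℕ.* m)))))
        -- For a pair, the inverse factorial of the inner factor stands between the two operators
        -- and has to be pulled out by `∇-scale`.
        ≈⟨ +-cong (ΣF.sum-cong (allFin n) square) (ΣF.pairSum-cong n λ i j _ →
             *-cong refl (trans (eval₀-cong (∇-scale i _ _)) (*-cong refl (eval₀-∇∇ i j)))) ⟩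
      (ΣF.sum (allFin n) λ i → diagonal i * diagonal i) +
      ΣF.pairSum n (λ i j → recip! (1 ℕ.* m) * (recip! (1 ℕ.* m) * interaction i j)) ∎)
      where
      square : ∀ i → recip! (2 ℕ.* m) * eval₀ (∇ k T i (∇ k T i (trA^ (2 ℕ.* m)))) ≈ diagonal i * diagonal i
      square i = begin
        recip! (2 ℕ.* m) * eval₀ (∇ k T i (∇ k T i (trA^ (2 ℕ.* m)))) ≈⟨ *-cong refl (trans (eval₀-∇∇ i i) (interaction-self i)) ⟩
        recip! (2 ℕ.* m) * (diagonal i * diagonal i * fromℕ ((2 ℕ.* m) !)) ≈⟨ *-cong refl (*-comm _ _) ⟩
        recip! (2 ℕ.* m) * (fromℕ ((2 ℕ.* m) !) * (diagonal i * diagonal i)) ≈⟨ *-assoc _ _ _ ⟨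
        recip! (2 ℕ.* m) * fromℕ ((2 ℕ.* m) !) * (diagonal i * diagonal i) ≈⟨ *-cong (recip!-inverse (2 ℕ.* m)) refl ⟩
        1# * (diagonal i * diagonal i) ≈⟨ *-identityˡ _ ⟩
        diagonal i * diagonal i ∎

  -- Entries and interactions of the tensor of a hypergraph

  module HypergraphTensor {n : ℕ} (m′ : ℕ) (H : Hypergraph (suc (suc m′)) n) (α : Carrier) where

    open SetoidReasoning F.setoid
    open DecMembership (_≟ˢ_ {n}) using () renaming (_∈?_ to _∈ᴱ?_)

    private
      m k : ℕ
      m = suc m′
      k = suc m

      T : Tensor k n
      T = 𝒜[_] H α

    support : Fin n → Vec (Fin n) m → Subset n
    support i γ = ⋃ (map ⁅_⁆ (i ∷ Vec.toList γ))

    ⋃-⊆ : ∀ (xs : List (Fin n)) {s} → (∀ {l} → l ∈ xs → l Subset.∈ s) → ⋃ (map ⁅_⁆ xs) Subset.⊆ s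
    ⋃-⊆ []       xs⊆s l∈ = contradiction l∈ ∉⊥
    ⋃-⊆ (x ∷ xs) xs⊆s l∈ with x∈p∪q⁻ ⁅ x ⁆ _ l∈
    ... | inj₁ l∈x = ≡.subst (Subset._∈ _) (≡.sym (x∈⁅y⁆⇒x≡y x l∈x)) (xs⊆s (here ≡.refl))
    ... | inj₂ l∈′ = ⋃-⊆ xs (xs⊆s ∘ there) l∈′

    -- The support of (i , γ) lies in s and so has too few vertices to be an edge.
    𝒜-small : ∀ i γ {s} → (∀ {l} → l ∈ i ∷ Vec.toList γ → l Subset.∈ s) → ∣ s ∣ ℕ.< k → 𝒜 H i γ ≡ 0#
    𝒜-small i γ xs⊆s s<k = ≡.cong (if_then recip! m else 0#) (dec-false (support i γ ∈ᴱ? edges H) λ e∈ →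
      ℕ.<-irrefl (All.lookup (uniform H) e∈) (ℕ.≤-<-trans (p⊆q⇒∣p∣≤∣q∣ (⋃-⊆ (i ∷ Vec.toList γ) xs⊆s)) s<k))

    𝒟-nonconstant : ∀ i γ → γ ≢ Vec.replicate m i → 𝒟 H i γ ≡ 0#
    𝒟-nonconstant i γ γ≢ = ≡.cong (if_then fromℕ (degree H i) else 0#)
      (dec-false (VecAll.all? (i Fin.≟_) γ) (γ≢ ∘ constant))
      where
      constant : ∀ {p} {δ : Vec (Fin n) p} → VecAll.All (i ≡_) δ → δ ≡ Vec.replicate p i
      constant VecAll.[]              = ≡.refl
      constant (≡.refl VecAll.∷ all) = ≡.cong (i ∷_) (constant all)

    toList-replicate : ∀ p {i l : Fin n} → l ∈ Vec.toList (Vec.replicate p i) → l ≡ i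
    toList-replicate (suc p) (here l≡i) = l≡i
    toList-replicate (suc p) (there l∈) = toList-replicate p l∈

    T-nonconstant : ∀ i γ → γ ≢ Vec.replicate m i → T i γ ≈ (1# − α) * 𝒜 H i γ
    T-nonconstant i γ γ≢ = trans
      (+-cong (trans (*-cong refl (reflexive (𝒟-nonconstant i γ γ≢))) (F.zeroʳ α)) refl) (+-identityˡ _)

    T-diagonal : ∀ i → diagonal m′ T i ≈ α * fromℕ (degree H i)
    T-diagonal i = trans (+-cong (*-cong refl (reflexive 𝒟-diagonal))
      (trans (*-cong refl (reflexive 𝒜-diagonal)) (F.zeroʳ _))) (+-identityʳ _)
      where
      rep : Vec (Fin n) m
      rep = Vec.replicate m i
      all-replicate : ∀ p → VecAll.All (i ≡_) (Vec.replicate p i)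
      all-replicate zero    = VecAll.[]
      all-replicate (suc p) = ≡.refl VecAll.∷ all-replicate p
      𝒟-diagonal : 𝒟 H i rep ≡ fromℕ (degree H i)
      𝒟-diagonal = ≡.cong (if_then fromℕ (degree H i) else 0#) (dec-true (VecAll.all? (i Fin.≟_) rep) (all-replicate m))
      𝒜-diagonal : 𝒜 H i rep ≡ 0#
      𝒜-diagonal = 𝒜-small i rep {⁅ i ⁆}
        (λ { (here ≡.refl) → x∈⁅x⁆ i ; (there l∈) → ≡.subst (Subset._∈ ⁅ i ⁆) (≡.sym (toList-replicate m l∈)) (x∈⁅x⁆ i) })
        (ℕ.≤-trans (ℕ.s≤s (ℕ.≤-reflexive (∣⁅x⁆∣≡1 i))) (ℕ.s≤s (ℕ.s≤s ℕ.z≤n)))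

    -- T i γ is negligible when every vertex of γ is i or j but γ is not
    -- constantly i, since an edge has more than two vertices.
    data Shape (i j : Fin n) (γ : Vec (Fin n) m) : Set (c ⊔ ℓ₁) where
      third    : ∀ {l} → l ∈ Vec.toList γ → i ≢ l → j ≢ l → Shape i j γ
      constant : γ ≡ Vec.replicate m i → Shape i j γ
      negligible : T i γ ≈ 0# → Shape i j γ

    shape : 3 ℕ.≤ k → ∀ i j γ → Shape i j γ
    shape 3≤k i j γ with Any.any? (λ l → ¬? (i Fin.≟ l) ×-dec ¬? (j Fin.≟ l)) (Vec.toList γ)
    ... | yes some = case find some of λ where (l , l∈γ , i≢l , j≢l) → third l∈γ i≢l j≢l
    ... | no none with Vec.≡-dec Fin._≟_ γ (Vec.replicate m i)
    ...   | yes γ≡ = constant γ≡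
    ...   | no γ≢  = negligible (trans (T-nonconstant i γ γ≢) (trans (*-cong refl (reflexive
              (𝒜-small i γ {⁅ i ⁆ ∪ ⁅ j ⁆} inPair small))) (F.zeroʳ _)))
      where
      i∈ : i Subset.∈ ⁅ i ⁆ ∪ ⁅ j ⁆
      i∈ = x∈p∪q⁺ (inj₁ (x∈⁅x⁆ i))
      inPair : ∀ {l} → l ∈ i ∷ Vec.toList γ → l Subset.∈ ⁅ i ⁆ ∪ ⁅ j ⁆
      inPair (here ≡.refl) = i∈
      inPair {l} (there l∈γ) with i Fin.≟ l | j Fin.≟ l
      ... | yes ≡.refl | _          = i∈
      ... | no _       | yes ≡.refl = x∈p∪q⁺ {p = ⁅ i ⁆} (inj₂ (x∈⁅x⁆ j))
      ... | no i≢l     | no j≢l     = contradiction (lose l∈γ (i≢l , j≢l)) none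
      small : ∣ ⁅ i ⁆ ∪ ⁅ j ⁆ ∣ ℕ.< k
      small = ℕ.≤-<-trans (∣p∪q∣≤∣p∣+∣q∣ ⁅ i ⁆ ⁅ j ⁆)
        (≡.subst (ℕ._< k) (≡.sym (≡.cong₂ ℕ._+_ (∣⁅x⁆∣≡1 i) (∣⁅x⁆∣≡1 j))) 3≤k)

    pairing-diagonal : ∀ {i j} → i ≢ j → pairing m′ T i (Vec.replicate m i) j (Vec.replicate m j) ≈ 0#
    pairing-diagonal {i} {j} i≢j = Diagonal.eval₀-trA^-mixed i≢j (m′ ℕ.+ 1 ℕ.* m)
      (isDiagonal i) (isDiagonal j) (here ≡.refl) (here ≡.refl)
      where
      isDiagonal : ∀ a → All Diagonal.IsDiagonal (row a (Vec.replicate m a))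
      isDiagonal a = ≡.subst (All Diagonal.IsDiagonal) (≡.sym (row-replicate m a)) (All.replicate⁺ m ≡.refl)

    -- Besides edges, the diagonal entries have to be excluded. With γ constantly i and δ constantly
    -- j the prescribed arcs are loops at two different vertices, and no closed walk joins them
    -- without a further arc.
    interaction-zero : 3 ℕ.≤ k → ∀ {i j} → i ≢ j → interaction m′ T i j ≈ 0#
    interaction-zero 3≤k {i} {j} i≢j = ΣF.sum-zero (tuples n m) λ γ → outer γ (shape 3≤k i j γ)
      where
      zeroʳ′ : ∀ {x y} → y ≈ 0# → x * y ≈ 0#
      zeroʳ′ y≈0 = trans (*-cong refl y≈0) (F.zeroʳ _)
      zeroˡ′ : ∀ {x y} → x ≈ 0# → x * y ≈ 0#
      zeroˡ′ x≈0 = trans (*-cong x≈0 refl) (F.zeroˡ _)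

      constantInner : ∀ δ → Shape j i δ → T j δ * pairing m′ T i (Vec.replicate m i) j δ ≈ 0#
      constantInner δ (third l∈δ j≢l i≢l) = zeroʳ′ (pairing-avoiding m′ T (Vec.replicate m i) δ i≢l j≢l (inj₂ l∈δ))
      constantInner δ (constant ≡.refl)   = zeroʳ′ (pairing-diagonal i≢j)
      constantInner δ (negligible Tδ≈0)   = zeroˡ′ Tδ≈0

      outer : ∀ γ → Shape i j γ → T i γ * ΣF.sum (tuples n m) (λ δ → T j δ * pairing m′ T i γ j δ) ≈ 0#
      outer γ (third l∈γ i≢l j≢l) = zeroʳ′ (ΣF.sum-zero (tuples n m) λ δ →
        zeroʳ′ (pairing-avoiding m′ T γ δ i≢l j≢l (inj₁ l∈γ)))
      outer γ (constant ≡.refl)   = zeroʳ′ (ΣF.sum-zero (tuples n m) λ δ → constantInner δ (shape 3≤k j i δ))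
      outer γ (negligible Tγ≈0)   = zeroˡ′ Tγ≈0

  -- Graphs, the case k = 2

  module GraphTensor {n : ℕ} (H : Hypergraph 2 n) (α : Carrier) where

    open HypergraphTensor 0 H α
    open SetoidReasoning F.setoid
    open DecMembership (_≟ˢ_ {n}) using () renaming (_∈?_ to _∈ᴱ?_)

    private
      T : Tensor 2 n
      T = 𝒜[_] H α

    weight : Carrier
    weight = (1# − α) * recip! 1

    T-edge : ∀ {i j} → i ≢ j → T i (j ∷ []) ≈ ΣF.indicator ((⁅ i ⁆ ∪ ⁅ j ⁆) ∈ᴱ? edges H) weight
    T-edge {i} {j} i≢j = trans (T-nonconstant i (j ∷ []) (≡.≢-sym i≢j ∘ ≡.cong Vec.head)) entry
      where
      support≡ : support i (j ∷ []) ≡ ⁅ i ⁆ ∪ ⁅ j ⁆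
      support≡ = ≡.cong (⁅ i ⁆ ∪_) (∪-identityʳ ⁅ j ⁆)
      entry : (1# − α) * 𝒜 H i (j ∷ []) ≈ ΣF.indicator ((⁅ i ⁆ ∪ ⁅ j ⁆) ∈ᴱ? edges H) weight
      entry rewrite support≡ with does ((⁅ i ⁆ ∪ ⁅ j ⁆) ∈ᴱ? edges H)
      ... | true  = refl
      ... | false = F.zeroʳ _

    -- Two arcs leaving i and j form a closed walk of length 2 only if they are each other's
    -- reverse; the factor 2 counts its starting points.
    interaction-graph : ∀ i j → interaction 0 T i j ≈ T i (j ∷ []) * (T j (i ∷ []) * (1# + 1#))
    interaction-graph i j = begin
      interaction 0 T i j
        ≈⟨ ΣF.sum-tuples-single (j ∷ []) (λ { (l ∷ []) γ≢ → trans (*-cong refl (ΣF.sum-zero (tuples n 1)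
             λ { (l′ ∷ []) → trans (*-cong refl (off (γ≢ ∘ ≡.cong (_∷ []) ∘ ≡.cong proj₂))) (F.zeroʳ _) })) (F.zeroʳ _) }) ⟩
      T i (j ∷ []) * (ΣF.sum (tuples n 1) λ δ → T j δ * pairing 0 T i (j ∷ []) j δ)
        ≈⟨ *-cong refl (ΣF.sum-tuples-single (i ∷ []) λ { (l′ ∷ []) δ≢ →
             trans (*-cong refl (off (δ≢ ∘ ≡.cong (_∷ []) ∘ ≡.sym ∘ ≡.cong proj₁))) (F.zeroʳ _) }) ⟩
      T i (j ∷ []) * (T j (i ∷ []) * pairing 0 T i (j ∷ []) j (i ∷ []))
        ≈⟨ *-cong refl (*-cong refl (trans (Full.eval₀-trA^2 i j j i)
             (+-cong (reflexive (δ#-≡ (i , j))) (reflexive (δ#-≡ (i , j)))))) ⟩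
      T i (j ∷ []) * (T j (i ∷ []) * (1# + 1#)) ∎
      where
      off : ∀ {l l′} → (i , l) ≢ (l′ , j) → pairing 0 T i (l ∷ []) j (l′ ∷ []) ≈ 0#
      off {l} {l′} ne = trans (Full.eval₀-trA^2 i l j l′)
        (trans (+-cong (reflexive (δ#-≢ ne)) (reflexive (δ#-≢ ne))) (+-identityˡ 0#))

    edgeTerm : Carrier
    edgeTerm = recip! 1 * (recip! 1 * (weight * (weight * (1# + 1#))))

    -- The indicator of being an edge is spread over the list of edges, which is repetition-free,
    -- and the sums are exchanged; each edge is then met by exactly one pair i < j.
    pairSum-interaction : ΣF.pairSum n (λ i j → recip! 1 * (recip! 1 * interaction 0 T i j)) ≈
                          length (edges H) · edgeTerm
    pairSum-interaction = begin
      ΣF.pairSum n (λ i j → recip! 1 * (recip! 1 * interaction 0 T i j))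
        ≈⟨ ΣF.pairSum-cong n (λ i j i≢j → trans (*-cong refl (*-cong refl (trans (interaction-graph i j)
             (*-cong (T-edge i≢j) (*-cong (trans (T-edge (≡.≢-sym i≢j)) (reflexive (flip i j))) refl)))))
             (trans (collect i j) (expand i j))) ⟩
      ΣF.pairSum n (λ i j → ΣF.sum (edges H) λ e → ΣF.indicator ((⁅ i ⁆ ∪ ⁅ j ⁆) ≟ˢ e) edgeTerm)
        ≈⟨ ΣF.pairSum-sum n (edges H) _ ⟩
      ΣF.sum (edges H) (λ e → ΣF.pairSum n λ i j → ΣF.indicator ((⁅ i ⁆ ∪ ⁅ j ⁆) ≟ˢ e) edgeTerm)
        ≈⟨ count (uniform H) ⟩
      length (edges H) · edgeTerm ∎
      where
      flip : ∀ i j → ΣF.indicator ((⁅ j ⁆ ∪ ⁅ i ⁆) ∈ᴱ? edges H) weight ≡ ΣF.indicator ((⁅ i ⁆ ∪ ⁅ j ⁆) ∈ᴱ? edges H) weight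
      flip i j rewrite ∪-comm ⁅ i ⁆ ⁅ j ⁆ = ≡.refl

      collect : ∀ i j → let w = ΣF.indicator ((⁅ i ⁆ ∪ ⁅ j ⁆) ∈ᴱ? edges H) weight in
                recip! 1 * (recip! 1 * (w * (w * (1# + 1#)))) ≈ ΣF.indicator ((⁅ i ⁆ ∪ ⁅ j ⁆) ∈ᴱ? edges H) edgeTerm
      collect i j with does ((⁅ i ⁆ ∪ ⁅ j ⁆) ∈ᴱ? edges H)
      ... | true  = refl
      ... | false = trans (*-cong refl (trans (*-cong refl (F.zeroˡ _)) (F.zeroʳ _))) (F.zeroʳ _)

      expand : ∀ i j → ΣF.indicator ((⁅ i ⁆ ∪ ⁅ j ⁆) ∈ᴱ? edges H) edgeTerm ≈
                       ΣF.sum (edges H) λ e → ΣF.indicator ((⁅ i ⁆ ∪ ⁅ j ⁆) ≟ˢ e) edgeTerm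
      expand i j with (⁅ i ⁆ ∪ ⁅ j ⁆) ∈ᴱ? edges H
      ... | yes e∈ = sym (ΣF.sum-indicator-∈ _≟ˢ_ edgeTerm (unique H) e∈)
      ... | no e∉  = sym (ΣF.sum-indicator-∉ _≟ˢ_ edgeTerm e∉)

      count : ∀ {es : List (Subset n)} → All (λ e → ∣ e ∣ ≡ 2) es →
              ΣF.sum es (λ e → ΣF.pairSum n λ i j → ΣF.indicator ((⁅ i ⁆ ∪ ⁅ j ⁆) ≟ˢ e) edgeTerm) ≈ length es · edgeTerm
      count []               = refl
      count {e ∷ _} (∣e∣≡2 ∷ all) = +-cong (ΣF.pairSum-edge e edgeTerm ∣e∣≡2) (count all)

  -- Comparison of the traces in the ordered field

  sum-distribˡ : ∀ (xs : List A) a {f : A → Carrier} → a * ΣF.sum xs f ≈ ΣF.sum xs (λ x → a * f x)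
  sum-distribˡ []       a = F.zeroʳ a
  sum-distribˡ (x ∷ xs) a = trans (F.distribˡ _ _ _) (+-cong refl (sum-distribˡ xs a))

  fromℕ-sum : ∀ (xs : List A) (f : A → ℕ) → fromℕ (ΣN.sum xs f) ≈ ΣF.sum xs (fromℕ ∘ f)
  fromℕ-sum []       f = refl
  fromℕ-sum (x ∷ xs) f = trans (fromℕ-+ (f x) _) (+-cong refl (fromℕ-sum xs f))

  fromℕ-mono-< : ∀ {a b} → a ℕ.< b → fromℕ a < fromℕ b
  fromℕ-mono-< {a} {b} a<b = <-respˡ-≈ (+-identityˡ _) (<-respʳ-≈
    (trans (sym (fromℕ-+ (suc d) a)) (reflexive (≡.cong fromℕ (≡.trans (≡.sym (ℕ.+-suc d a)) (ℕ.m∸n+n≡m a<b)))))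
    (+-monoˡ-< (fromℕ a) (fromℕ-pos d)))
    where
    -- Chosen so that `suc d` is the difference of b and a, the form to which `fromℕ-pos` applies.
    d : ℕ
    d = b ℕ.∸ suc a

  -- The product of x and z - y is positive; adding x * y gives the claim.
  *-monoˡ-< : ∀ {x y z} → 0# < x → y < z → x * y < x * z
  *-monoˡ-< {x} {y} {z} 0<x y<z = <-respˡ-≈ (+-identityˡ _) (<-respʳ-≈
    (trans (sym (F.distribˡ x _ _)) (*-cong refl (trans (+-assoc _ _ _)
      (trans (+-cong refl (F.-‿inverseˡ y)) (+-identityʳ z)))))
    (+-monoˡ-< (x * y) (*-pos 0<x (<-respˡ-≈ (F.-‿inverseʳ y) (+-monoˡ-< (- y) y<z)))))

  interactions : ∀ m′ {n} (G : Hypergraph (suc (suc m′)) n) → Carrier → Carrier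
  interactions m′ {n} G α = ΣF.pairSum n λ i j →
    recip! (1 ℕ.* suc m′) * (recip! (1 ℕ.* suc m′) * interaction m′ (𝒜[_] G α) i j)

  interactions-zero : ∀ m″ {n} (G : Hypergraph (suc (suc (suc m″))) n) α → interactions (suc m″) G α ≈ 0#
  interactions-zero m″ {n} G α = ΣF.pairSum-zero n λ i j i≢j → trans (*-cong refl (trans (*-cong refl
    (HypergraphTensor.interaction-zero (suc m″) G α (ℕ.s≤s (ℕ.s≤s (ℕ.s≤s ℕ.z≤n))) i≢j)) (F.zeroʳ _))) (F.zeroʳ _)

  interactions-≈ : ∀ m′ {n} (H H′ : Hypergraph (suc (suc m′)) n) α → length (edges H) ≡ length (edges H′) →
                   interactions m′ H α ≈ interactions m′ H′ α
  interactions-≈ zero     H H′ α eq = trans (GraphTensor.pairSum-interaction H α)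
    -- The value of `edgeTerm` depends on α alone, so both sides are multiples of one element.
    (trans (reflexive (≡.cong (_· GraphTensor.edgeTerm H α) eq)) (sym (GraphTensor.pairSum-interaction H′ α)))
  interactions-≈ (suc m″) H H′ α _  = trans (interactions-zero m″ H α) (sym (interactions-zero m″ H′ α))

  module Comparison {n : ℕ} (m′ : ℕ) (H H′ : Hypergraph (suc (suc m′)) n) {u v : Fin n} (u≢v : u ≢ v)
                    (isσ : IsσTransformation H u v H′) (α : Carrier) where

    open σTransformation H u≢v H′ isσ
    open SetoidReasoning F.setoid

    private
      m k : ℕ
      m = suc m′
      k = suc m

    sum-diagonal : ∀ G → ΣF.sum (allFin n) (diagonal m′ (𝒜[_] G α)) ≈ α * fromℕ (degreeSum G)
    sum-diagonal G = begin
      ΣF.sum (allFin n) (diagonal m′ (𝒜[_] G α))       ≈⟨ ΣF.sum-cong (allFin n) (HypergraphTensor.T-diagonal m′ G α) ⟩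
      ΣF.sum (allFin n) (λ i → α * fromℕ (degree G i)) ≈⟨ sum-distribˡ (allFin n) α ⟨
      α * ΣF.sum (allFin n) (fromℕ ∘ degree G)         ≈⟨ *-cong refl (fromℕ-sum (allFin n) _) ⟨
      α * fromℕ (degreeSum G)                          ∎

    sum-diagonal² : ∀ G → ΣF.sum (allFin n) (λ i → diagonal m′ (𝒜[_] G α) i * diagonal m′ (𝒜[_] G α) i) ≈
                          α * α * fromℕ (squareSum G)
    sum-diagonal² G = begin
      ΣF.sum (allFin n) (λ i → diagonal m′ (𝒜[_] G α) i * diagonal m′ (𝒜[_] G α) i)
        ≈⟨ ΣF.sum-cong (allFin n) (λ i → trans (*-cong (T-diagonal i) (T-diagonal i)) (trans (interchange _ _ _ _)
             (*-cong refl (sym (fromℕ-* (degree G i) (degree G i)))))) ⟩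
      ΣF.sum (allFin n) (λ i → α * α * fromℕ (degree G i ℕ.* degree G i))
        ≈⟨ sum-distribˡ (allFin n) (α * α) ⟨
      α * α * ΣF.sum (allFin n) (λ i → fromℕ (degree G i ℕ.* degree G i))
        ≈⟨ *-cong refl (fromℕ-sum (allFin n) _) ⟨
      α * α * fromℕ (squareSum G) ∎
      where
      open HypergraphTensor m′ G α using (T-diagonal)
      open CommutativeSemigroupProperties F.*-commutativeSemigroup using (interchange)

    Tr₁-≈ : Tr k (𝒜[_] H α) 1 ≈ Tr k (𝒜[_] H′ α) 1
    Tr₁-≈ = begin
      Tr k (𝒜[_] H α) 1                                            ≈⟨ Tr-1 m′ (𝒜[_] H α) ⟩
      _ * ΣF.sum (allFin n) (diagonal m′ (𝒜[_] H α))               ≈⟨ *-cong refl (sum-diagonal H) ⟩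
      fromℕ (m ℕ.^ (n ℕ.∸ 1)) * (α * fromℕ (degreeSum H))          ≡⟨ ≡.cong (λ d → fromℕ (m ℕ.^ (n ℕ.∸ 1)) * (α * fromℕ d)) degreeSum-≡ ⟩
      fromℕ (m ℕ.^ (n ℕ.∸ 1)) * (α * fromℕ (degreeSum H′))         ≈⟨ *-cong refl (sum-diagonal H′) ⟨
      _ * ΣF.sum (allFin n) (diagonal m′ (𝒜[_] H′ α))              ≈⟨ Tr-1 m′ (𝒜[_] H′ α) ⟨
      Tr k (𝒜[_] H′ α) 1                                           ∎

    Tr₂ : ∀ G → Tr k (𝒜[_] G α) 2 ≈ fromℕ (m ℕ.^ (n ℕ.∸ 1)) * (α * α * fromℕ (squareSum G) + interactions m′ G α)
    Tr₂ G = trans (Tr-2 m′ (𝒜[_] G α)) (*-cong refl (+-cong (sum-diagonal² G) refl))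

    edges-length : length (edges H′) ≡ length (edges H)
    edges-length = ≡.trans (↭-length isσ) (List.length-map (movePendant H u v) (edges H))

    Tr₂-< : 0# < α → squareSum H ℕ.< squareSum H′ →
            Tr k (𝒜[_] H α) 2 < Tr k (𝒜[_] H′ α) 2
    Tr₂-< 0<α squares< = <-respˡ-≈ (sym (Tr₂ H)) (<-respʳ-≈
      (sym (trans (Tr₂ H′) (*-cong refl (+-cong refl (interactions-≈ m′ H′ H α edges-length)))))
      (*-monoˡ-< (fromℕ-mono-< (ℕ.m^n>0 m (n ℕ.∸ 1)))
        (+-monoˡ-< (interactions m′ H α) (*-monoˡ-< (*-pos 0<α 0<α) (fromℕ-mono-< squares<)))))

    -- From 2 ≤ k < n comes n ≥ 3, and the power of m is at least 1, so there are at least three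
    -- eigenvalues.
    traceCount : 1 ℕ.≤ s → 2 ℕ.≤ n ℕ.* m ℕ.^ (n ℕ.∸ 1) ℕ.∸ 1
    traceCount 1≤s = ℕ.∸-monoˡ-≤ 1 (ℕ.≤-trans (ℕ.≤-trans (ℕ.s≤s (ℕ.s≤s (ℕ.s≤s ℕ.z≤n))) (order-bound 1≤s))
      (ℕ.m≤m*n n (m ℕ.^ (n ℕ.∸ 1)) {{ℕ.m^n≢0 m (n ℕ.∸ 1)}}))

    σ-≺ : 1 ℕ.≤ s → degree H u ℕ.< degree H v ℕ.+ s → 0# < α → H ≺[ α ] H′
    σ-≺ 1≤s du<dv+s 0<α = 2 , ℕ.s≤s ℕ.z≤n , traceCount 1≤s , below , Tr₂-< 0<α (squareSum-< 1≤s du<dv+s)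
      where
      below : ∀ t → t ℕ.< 2 → Tr k (𝒜[_] H α) t ≈ Tr k (𝒜[_] H′ α) t
      below 0 _ = refl
      below 1 _ = Tr₁-≈
      below (suc (suc _)) (ℕ.s≤s (ℕ.s≤s ()))

lemma4p1 : ∀ {c ℓ₁ ℓ₂} (F : OrderedField c ℓ₁ ℓ₂)
    (let open OrderedField F) (let open Traces F) →
    ∀ (k n : ℕ) → 2 ℕ.≤ k →
    ∀ (H : Hypergraph k n) (u v : Fin n) → u ≢ v →
    (let s = length (pendantsAt H u)) → 1 ℕ.≤ s →
    degree H u ℕ.< degree H v ℕ.+ s →
    ∀ (H′ : Hypergraph k n) → IsσTransformation H u v H′ →
    ∀ (α : Carrier) → 0# < α → α < 1# →
    H ≺[ α ] H′
lemma4p1 F (suc (suc m′)) n (ℕ.s≤s (ℕ.s≤s _)) H u v u≢v 1≤s du<dv+s H′ isσ α 0<α _ =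
  TracePolynomials.Comparison.σ-≺ F m′ H H′ u≢v isσ α 1≤s du<dv+s 0<α
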